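{- There is an algorithm that maintains an online topological ordering of a directed acyclic graph $G$ on $n$ vertices under any sequence of insertions of $m$ edges in total time $O((m+n\log n)\sqrt{m})$.
   Context: Online topological ordering problem: the vertex set $V$, $|V|=n$, is fixed, and the directed graph $G$ on $V$ initially has no edges. Directed edges are given (inserted) one at a time and are not known in advance; there are no parallel edges, and $G$ is a directed acyclic graph. The algorithm must maintain a function $\mathrm{ord}$ on $V$ with values in a totally ordered set such that, after each insertion, $\mathrm{ord}(x)<\mathrm{ord}(y)$ holds for every edge $(x,y)$ inserted so far (a valid topological ordering). The function may be represented by a data structure answering comparisons "$\mathrm{ord}(x)<\mathrm{ord}(y)$?" in constant amortized time. Any ordering of $V$ is valid at the start. Running time is the worst-case total number of elementary operations (standard unit-cost RAM) over the whole sequence of $m$ insertions. It is assumed throughout that $m=\Omega(n)$ (and, since there are no parallel edges, $m=O(n^2)$). -}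

module Defs where

open import Data.Bool using (if_then_else_)
open import Data.Fin using (Fin; toℕ)
open import Data.List using (List; []; _∷_)
open import Data.List.Membership.Propositional using (_∈_)
open import Data.List.Relation.Unary.All using (All)
open import Data.List.Relation.Unary.Unique.Propositional using (Unique)
open import Data.Nat using (ℕ; suc; _+_; _*_; _∸_; _≤_; _<_; _≡ᵇ_)
open import Data.Product using (_×_; _,_)
open import Function.Bundles using (_⇔_)
open import Level using (0ℓ)
open import Relation.Binary.Bundles using (StrictTotalOrder)
open import Relation.Binary.Construct.Closure.Transitive using (TransClosure)
open import Relation.Binary.PropositionalEquality using (_≡_)
open import Relation.Nullary using (¬_)

-- Unit-cost RAM in the style of Cook and Reckhow: constants, addition,
-- (truncated) subtraction and indirect addressing on an unbounded memory of
-- natural numbers.  Control flow is structured, which changes running times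
-- by at most a constant factor with respect to conditional jumps.

Memory : Set
Memory = ℕ → ℕ

blank : Memory
blank _ = 0

infixl 20 _[_≔_]

_[_≔_] : Memory → ℕ → ℕ → Memory
(M [ i ≔ v ]) j = if i ≡ᵇ j then v else M j

infixr 5 _⨾_

data Program : Set where
  skip             : Program
  const            : (i c : ℕ) → Program
  add sub          : (i j k : ℕ) → Program
  load store       : (i j : ℕ) → Program
  _⨾_              : (p q : Program) → Program
  ifPos_then_else_ : (i : ℕ) (p q : Program) → Program
  whilePos_run_    : (i : ℕ) (p : Program) → Program

infix 4 ⟨_,_⟩⇓⟨_,_⟩

-- ⟨ p , M ⟩⇓⟨ t , M′ ⟩ : started in M, the program p halts in M′ after t
-- elementary operations.  Every instruction and every test costs 1.
data ⟨_,_⟩⇓⟨_,_⟩ : Program → Memory → ℕ → Memory → Set where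

  skip : ∀ {M} → ⟨ skip , M ⟩⇓⟨ 1 , M ⟩

  const : ∀ {M i c} → ⟨ const i c , M ⟩⇓⟨ 1 , M [ i ≔ c ] ⟩

  add : ∀ {M i j k} → ⟨ add i j k , M ⟩⇓⟨ 1 , M [ i ≔ M j + M k ] ⟩

  sub : ∀ {M i j k} → ⟨ sub i j k , M ⟩⇓⟨ 1 , M [ i ≔ M j ∸ M k ] ⟩

  load : ∀ {M i j} → ⟨ load i j , M ⟩⇓⟨ 1 , M [ i ≔ M (M j) ] ⟩

  store : ∀ {M i j} → ⟨ store i j , M ⟩⇓⟨ 1 , M [ M i ≔ M j ] ⟩

  seq : ∀ {M M′ M″ p q s t} →
    ⟨ p , M ⟩⇓⟨ s , M′ ⟩ → ⟨ q , M′ ⟩⇓⟨ t , M″ ⟩ →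
    ⟨ p ⨾ q , M ⟩⇓⟨ s + t , M″ ⟩

  if-pos : ∀ {M M′ i p q t} → 0 < M i → ⟨ p , M ⟩⇓⟨ t , M′ ⟩ →
    ⟨ ifPos i then p else q , M ⟩⇓⟨ suc t , M′ ⟩

  if-zero : ∀ {M M′ i p q t} → M i ≡ 0 → ⟨ q , M ⟩⇓⟨ t , M′ ⟩ →
    ⟨ ifPos i then p else q , M ⟩⇓⟨ suc t , M′ ⟩

  while-pos : ∀ {M M′ M″ i p s t} → 0 < M i →
    ⟨ p , M ⟩⇓⟨ s , M′ ⟩ → ⟨ whilePos i run p , M′ ⟩⇓⟨ t , M″ ⟩ →
    ⟨ whilePos i run p , M ⟩⇓⟨ suc (s + t) , M″ ⟩

  while-zero : ∀ {M i p} → M i ≡ 0 → ⟨ whilePos i run p , M ⟩⇓⟨ 1 , M ⟩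

Edge : ℕ → Set
Edge n = Fin n × Fin n

Acyclic : ∀ {n} → List (Edge n) → Set
Acyclic G = ∀ x → ¬ TransClosure (λ u v → (u , v) ∈ G) x x

data Request (n : ℕ) : Set where
  insert  : Edge n → Request n
  compare : (x y : Fin n) → Request n

insertions : ∀ {n} → List (Request n) → List (Edge n)
insertions []                 = []
insertions (insert e    ∷ rs) = e ∷ insertions rs
insertions (compare _ _ ∷ rs) = insertions rs

#comparisons : ∀ {n} → List (Request n) → ℕ
#comparisons []                 = 0
#comparisons (insert _    ∷ rs) = #comparisons rs
#comparisons (compare _ _ ∷ rs) = suc (#comparisons rs)

-- The graph of all inserted edges is acyclic iff all intermediate graphs are.
Admissible : ∀ {n} → List (Request n) → Set
Admissible rs = Unique (insertions rs) × Acyclic (insertions rs)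

-- The programs are fixed once and for all, independently of n.  `initialise`
-- finds n in cell 0; the other two find their arguments in cells 0 and 1.
-- `compare` leaves its answer in cell 0, a positive value meaning "yes".
record OnlineAlgorithm : Set where
  field
    initialise onInsert onCompare : Program

call : ∀ {n} → Memory → Edge n → Memory
call M (x , y) = M [ 0 ≔ toℕ x ] [ 1 ≔ toℕ y ]

module _ (A : OnlineAlgorithm) (O : StrictTotalOrder 0ℓ 0ℓ 0ℓ) where

  open OnlineAlgorithm A
  private module O = StrictTotalOrder O

  -- ord M is the function on vertices that the memory contents M represent.
  -- It plays no part in the computation.
  module _ {n : ℕ} (ord : Memory → Fin n → O.Carrier) where

    TopologicalOrdering : List (Edge n) → Memory → Set
    TopologicalOrdering G M =
      All (λ (x , y) → ord M x O.< ord M y) G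

    -- Correct service of a list of requests, one at a time, from memory M,
    -- when G lists the edges inserted before.
    data Serves (G : List (Edge n)) (M : Memory) : List (Request n) → Set where

      done : Serves G M []

      insert : ∀ {e rs t M′} →
        ⟨ onInsert , call M e ⟩⇓⟨ t , M′ ⟩ →
        TopologicalOrdering (e ∷ G) M′ →
        Serves (e ∷ G) M′ rs →
        Serves G M (insert e ∷ rs)

      compare : ∀ {x y rs t M′} →
        ⟨ onCompare , call M (x , y) ⟩⇓⟨ t , M′ ⟩ →
        (0 < M′ 0) ⇔ (ord M x O.< ord M y) →
        (∀ v → ord M′ v O.≈ ord M v) →
        Serves G M′ rs →
        Serves G M (compare x y ∷ rs)

    insertTime : ∀ {G M rs} → Serves G M rs → ℕ
    insertTime done                      = 0
    insertTime (insert {t = t} _ _ s)    = t + insertTime s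
    insertTime (compare _ _ _ s)         = insertTime s

    compareTime : ∀ {G M rs} → Serves G M rs → ℕ
    compareTime done                        = 0
    compareTime (insert _ _ s)              = compareTime s
    compareTime (compare {t = t} _ _ _ s)   = t + compareTime s

    record Execution (rs : List (Request n)) : Set where
      field
        {initTime}    : ℕ
        {initMemory}  : Memory
        initialised   : ⟨ initialise , blank [ 0 ≔ n ] ⟩⇓⟨ initTime , initMemory ⟩
        served        : Serves [] initMemory rs

      maintenanceTime : ℕ
      maintenanceTime = initTime + insertTime served

      totalTime : ℕ
      totalTime = maintenanceTime + compareTime served

infix 4 _≤_√_

-- t ≤ a √ m, squared.
_≤_√_ : ℕ → ℕ → ℕ → Set
t ≤ a √ m = t * t ≤ (a * a) * m

{-# OPTIONS --safe #-}
module Submission where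

-- The algorithm is a variant of the two-way search of Bender, Fineman, Gilbert
-- and Tarjan.  Levels never decrease along an edge.  When (v , w) is inserted,
-- a depth-first search from v backwards within the level k of v scans at most
-- k + 1 arcs.  If it completes, w is raised to level k, and otherwise to level
-- k + 1; a depth-first search forwards from w raises its descendants likewise.
-- The finishing order of each search is a topological order of what it visited,
-- and is used to move these vertices to the front of their level: the ancestors
-- of v first, then the raised descendants of w.
--
-- Every vertex of level k + 1 has k + 1 arcs into vertices of level k among its
-- ancestors, so m ≥ 1 + 2 + … + k if level k is occupied, and all levels are at
-- most S = ⌊√(2m)⌋.  A backward search therefore takes O(S) steps, and the
-- forward searches take O((m + n) S) steps altogether, since each scan of the
-- outgoing arcs of a vertex is paid for by raising that vertex.

open import Defs
open import Data.Bool using (true; false; T; if_then_else_)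
open import Data.Empty using (⊥; ⊥-elim)
open import Data.Fin as Fin using (Fin; toℕ; fromℕ<)
open import Data.Fin.Properties using (toℕ<n; toℕ-injective; toℕ-fromℕ<; injective⇒≤)
open import Data.List using (List; []; _∷_; map; length; _++_; lookup)
open import Data.List.Membership.Propositional using (_∈_; _∉_; find)
open import Data.List.Membership.Propositional.Properties using (∈-lookup; ∈-map⁺; ∈-map⁻)
open import Data.List.Properties using (length-++)
open import Data.List.Relation.Unary.All as All using (All; []; _∷_)
import Data.List.Relation.Unary.All.Properties as All
open import Data.List.Relation.Unary.AllPairs using (AllPairs; []; _∷_)
open import Data.List.Relation.Unary.Any using (here; there)
open import Data.List.Relation.Unary.Unique.Propositional using (Unique)
import Data.List.Relation.Unary.Unique.Propositional.Properties as Unique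
open import Data.Nat hiding (compare)
open import Data.Nat.DivMod using (_%_; [m+kn]%n≡m%n; m<n⇒m%n≡m)
open import Data.Nat.Logarithm using (⌊log₂_⌋)
open import Data.Nat.Properties
open import Data.Nat.Tactic.RingSolver using (solve-∀)
open import Data.Product using (Σ-syntax; ∃-syntax; _×_; _,_; proj₁; proj₂)
open import Data.Product.Relation.Binary.Lex.Strict using (×-strictTotalOrder)
open import Data.Sum as Sum using (_⊎_; inj₁; inj₂; [_,_])
open import Data.Unit using (tt)
open import Function.Bundles using (_⇔_; mk⇔; Equivalence)
open import Level using (0ℓ)
open import Relation.Binary.Bundles using (StrictTotalOrder)
open import Relation.Binary.Construct.Closure.ReflexiveTransitive using (Star; ε; _◅_; _◅◅_; gmap)
open import Relation.Binary.Construct.Closure.Transitive as Plus using (TransClosure; _∷ʳ_)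
import Relation.Binary.Construct.Flip.EqAndOrd as Flip
open import Relation.Binary.PropositionalEquality hiding ([_])
open import Relation.Nullary using (¬_; yes; no)

-- The program knows neither `m` nor its square root, so a search takes its budget from the level of
-- v; `S` exists only in the analysis. A search that exhausts its budget thereby certifies the next
-- level: the k + 1 arcs it has scanned are kept in the proof as evidence for level k + 1. Moving
-- vertices to the front of a level would normally call for renumbering or for an order-maintenance
-- structure. A key of level, stamp and rank replaces both: a fresh stamp from a growing clock beats
-- all older ones, so a move is two array writes, and marks never have to be cleared. A backward
-- search that is cut off is not undone. The vertices it has finished stay at the front of their
-- level, which is harmless because the finished set always contains its predecessors of the same
-- level. The machine has only loops, so the recursion is threaded through arrays: `PARENT` links
-- the stack and `CURSOR` holds the arcs left to scan. The relation used for acyclicity contains the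
-- new arc from the start, although the arc enters the lists only after both searches.

upd : {A : Set} → (ℕ → A) → ℕ → A → ℕ → A
upd f i a j = if i ≡ᵇ j then a else f j

≡ᵇ-refl : ∀ i → (i ≡ᵇ i) ≡ true
≡ᵇ-refl zero    = refl
≡ᵇ-refl (suc i) = ≡ᵇ-refl i

≢⇒≡ᵇ-false : ∀ {i j} → i ≢ j → (i ≡ᵇ j) ≡ false
≢⇒≡ᵇ-false {i} {j} i≢j with i ≡ᵇ j in eq
... | true  = ⊥-elim (i≢j (≡ᵇ⇒≡ i j (subst T (sym eq) tt)))
... | false = refl

upd-same : ∀ {A : Set} (f : ℕ → A) i {a} → upd f i a i ≡ a
upd-same f i rewrite ≡ᵇ-refl i = refl

upd-other : ∀ {A : Set} (f : ℕ → A) {a i j} → i ≢ j → upd f i a j ≡ f j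
upd-other f i≢j rewrite ≢⇒≡ᵇ-false i≢j = refl

upd-elim : ∀ {A : Set} (f : ℕ → A) {a} (P : A → Set) i j →
  (i ≡ j → P a) → (i ≢ j → P (f j)) → P (upd f i a j)
upd-elim f P i j same other with i ≟ j
... | yes refl = subst P (sym (upd-same f i)) (same refl)
... | no i≢j   = subst P (sym (upd-other f i≢j)) (other i≢j)

-- A language with named variables and arrays, compiled to the RAM

Var Arr : Set
Var = Fin 16
Arr = Fin 12

X Y EDGES CLOCK V W LATER EARLIER BUDGET FUEL TOP EDGE END TEST HEIGHT COUNT : Var
X = Fin.# 0
Y = Fin.# 1
EDGES = Fin.# 2
CLOCK = Fin.# 3
V = Fin.# 4
W = Fin.# 5
LATER = Fin.# 6
EARLIER = Fin.# 7
BUDGET = Fin.# 8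
FUEL = Fin.# 9
TOP = Fin.# 10
EDGE = Fin.# 11
END = Fin.# 12
TEST = Fin.# 13
HEIGHT = Fin.# 14
COUNT = Fin.# 15

LEVEL STAMP RANK OUTHEAD OUTNEXT INHEAD INNEXT SOURCE TARGET MARK CURSOR PARENT : Arr
LEVEL = Fin.# 0
STAMP = Fin.# 1
RANK = Fin.# 2
OUTHEAD = Fin.# 3
OUTNEXT = Fin.# 4
INHEAD = Fin.# 5
INNEXT = Fin.# 6
SOURCE = Fin.# 7
TARGET = Fin.# 8
MARK = Fin.# 9
CURSOR = Fin.# 10
PARENT = Fin.# 11

record State : Set where
  constructor state
  field
    var : Var → ℕ
    arr : Arr → ℕ → ℕ

open State public

setVar : State → Var → ℕ → State
setVar σ x c = state (λ y → if toℕ x ≡ᵇ toℕ y then c else var σ y) (arr σ)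

setArr : State → Arr → ℕ → ℕ → State
setArr σ A i c =
  state (var σ) (λ B → if toℕ A ≡ᵇ toℕ B then upd (arr σ A) i c else arr σ B)

infix  9 #_ ‵_
infix  8 _⊕_ _⊖_ _⟦_⟧
infix  7 _:=_ _⟦_⟧:=_
infixr 6 _؛_ when_then_else_

data Operand : Set where
  #_ : ℕ → Operand
  ‵_ : Var → Operand

data Expr : Set where
  val     : Operand → Expr
  _⊕_ _⊖_ : Operand → Operand → Expr
  _⟦_⟧    : Arr → Operand → Expr

data Stmt : Set where
  nop            : Stmt
  _:=_            : Var → Expr → Stmt
  _⟦_⟧:=_         : Arr → Operand → Operand → Stmt
  _؛_            : Stmt → Stmt → Stmt
  when_then_else_ : Var → Stmt → Stmt → Stmt

⟦_⟧ₒ : Operand → State → ℕ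
⟦ # c ⟧ₒ σ = c
⟦ ‵ x ⟧ₒ σ = var σ x

⟦_⟧ₑ : Expr → State → ℕ
⟦ val o ⟧ₑ σ = ⟦ o ⟧ₒ σ
⟦ o ⊕ p ⟧ₑ σ = ⟦ o ⟧ₒ σ + ⟦ p ⟧ₒ σ
⟦ o ⊖ p ⟧ₑ σ = ⟦ o ⟧ₒ σ ∸ ⟦ p ⟧ₒ σ
⟦ A ⟦ o ⟧ ⟧ₑ σ = arr σ A (⟦ o ⟧ₒ σ)

-- A branch on an unknown value thus leaves an ordinary term in the result of `exec`, which
-- `select-elim` splits in place, while straight-line code computes to an explicit state.
select : {A : Set} → ℕ → A → A → A
select zero    a b = b
select (suc _) a b = a

select-elim : ∀ {A : Set} (P : A → Set) c {a b} →
  (0 < c → P a) → (c ≡ 0 → P b) → P (select c a b)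
select-elim P zero    pos zer = zer refl
select-elim P (suc c) pos zer = pos z<s

exec : Stmt → State → State
exec nop                     σ = σ
exec (x := e)                 σ = setVar σ x (⟦ e ⟧ₑ σ)
exec (A ⟦ o ⟧:= p)            σ = setArr σ A (⟦ o ⟧ₒ σ) (⟦ p ⟧ₒ σ)
exec (p ؛ q)                 σ = exec q (exec p σ)
exec (when x then p else q)  σ = select (var σ x) (exec p σ) (exec q σ)

-- Loops are kept out of `Stmt`, so `exec` is a total function and only this relation has to count
-- rounds.
data Iterates (x : Var) (s : Stmt) : State → ℕ → State → Set where
  stop : ∀ {σ} → var σ x ≡ 0 → Iterates x s σ 0 σ
  next : ∀ {σ k σ′} → 0 < var σ x →
    Iterates x s (exec s σ) k σ′ → Iterates x s σ (suc k) σ′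

-- Variables occupy cells 0 to 15, cells 30 and 31 hold intermediate results,
-- and the arrays are interleaved from cell 32 onwards.

double : ℕ → ℕ
double i = i + i

base : Arr → ℕ
base A = 32 + toℕ A

-- The stride 16 is a power of two, so an address takes four doublings and one addition. Written
-- with `double`, it is definitionally the value that `address` computes.
cell : Arr → ℕ → ℕ
cell A i = double (double (double (double i))) + base A

double⁴ : ∀ i → double (double (double (double i))) ≡ i * 16
double⁴ i =
  trans (cong (λ k → double (double (double (double k)))) (sym (*-identityʳ i)))
  (trans (cong (λ k → double (double (double k))) (twice 1))
  (trans (cong (λ k → double (double k)) (twice 2))
  (trans (cong double (twice 4)) (twice 8))))
  where
  twice : ∀ k → double (i * k) ≡ i * (k + k)
  twice k = sym (*-distribˡ-+ i k k)

-- There are only twelve arrays, so the address less 32, taken modulo the stride, is the number of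
-- the array.
cell-injective : ∀ A B i j → cell A i ≡ cell B j → A ≡ B × i ≡ j
cell-injective A B i j eq = A≡B , *-cancelʳ-≡ i j 16 (+-cancelʳ-≡ (toℕ A) _ _ i≡j)
  where
  residue : ∀ (A : Arr) k → (toℕ A + k * 16) % 16 ≡ toℕ A
  residue A k = trans ([m+kn]%n≡m%n (toℕ A) k 16)
    (m<n⇒m%n≡m (≤-trans (toℕ<n A) (≤ᵇ⇒≤ 12 16 tt)))
  shape : ∀ A i → cell A i ≡ 32 + (toℕ A + i * 16)
  shape A i = begin
    double (double (double (double i))) + base A ≡⟨ cong (_+ base A) (double⁴ i) ⟩
    i * 16 + (32 + toℕ A)                      ≡⟨ +-comm (i * 16) _ ⟩
    32 + (toℕ A + i * 16)                      ∎
    where open ≡-Reasoning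
  eq′ : toℕ A + i * 16 ≡ toℕ B + j * 16
  eq′ = +-cancelˡ-≡ 32 _ _ (trans (sym (shape A i)) (trans eq (shape B j)))
  A≡B : A ≡ B
  A≡B = toℕ-injective
    (trans (sym (residue A i)) (trans (cong (_% 16) eq′) (residue B j)))
  i≡j : i * 16 + toℕ A ≡ j * 16 + toℕ A
  i≡j = begin
    i * 16 + toℕ A ≡⟨ +-comm (i * 16) _ ⟩
    toℕ A + i * 16 ≡⟨ eq′ ⟩
    toℕ B + j * 16 ≡⟨ +-comm (toℕ B) _ ⟩
    j * 16 + toℕ B ≡⟨ cong (λ C → j * 16 + toℕ C) (sym A≡B) ⟩
    j * 16 + toℕ A ∎
    where open ≡-Reasoning

var<30 : ∀ (x : Var) → toℕ x < 30
var<30 x = ≤-trans (toℕ<n x) (≤ᵇ⇒≤ 16 30 tt)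

cell≥32 : ∀ A i → 32 ≤ cell A i
cell≥32 A i = ≤-trans (m≤m+n 32 (toℕ A)) (m≤n+m (base A) _)

-- Memories that represent states

infix 4 _Represents_

-- Nothing is said about the scratch cells, so intermediate results may overwrite them freely.
record _Represents_ (M : Memory) (σ : State) : Set where
  field
    vars : ∀ x → M (toℕ x) ≡ var σ x
    arrs : ∀ A i → M (cell A i) ≡ arr σ A i

open _Represents_ public

Scratch : ℕ → Set
Scratch t = 30 ≤ t × t < 32

scratch-invisible : ∀ {M σ t c} → Scratch t → M Represents σ → M [ t ≔ c ] Represents σ
scratch-invisible {M} {t = t} (30≤t , t<32) rep .vars x =
  trans (upd-other M {i = t} (λ { refl → <⇒≱ (var<30 x) 30≤t })) (rep .vars x)
scratch-invisible {M} {t = t} (30≤t , t<32) rep .arrs A i =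
  trans (upd-other M {i = t} (λ { refl → <⇒≱ t<32 (cell≥32 A i) })) (rep .arrs A i)

var≢cell : ∀ (x : Var) A i → toℕ x ≢ cell A i
var≢cell x A i eq =
  <⇒≱ (var<30 x) (≤-trans (≤ᵇ⇒≤ 30 32 tt) (subst (32 ≤_) (sym eq) (cell≥32 A i)))

setVar-represents : ∀ {M σ c} x → M Represents σ → M [ toℕ x ≔ c ] Represents setVar σ x c
setVar-represents x rep .vars y with toℕ x ≡ᵇ toℕ y
... | true  = refl
... | false = rep .vars y
setVar-represents {M} x rep .arrs A i = trans (upd-other M (var≢cell x A i)) (rep .arrs A i)

setArr-represents : ∀ {M σ c} A i → M Represents σ → M [ cell A i ≔ c ] Represents setArr σ A i c
setArr-represents {M} A i rep .vars x =
  trans (upd-other M (λ eq → var≢cell x A i (sym eq))) (rep .vars x)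
setArr-represents {M} {σ} {c} A i rep .arrs B j with A Fin.≟ B
... | yes refl rewrite ≡ᵇ-refl (toℕ A) =
  upd-elim M (_≡ upd (arr σ A) i c j) (cell A i) (cell A j)
    (λ eq → trans (sym (upd-same (arr σ A) i))
      (cong (upd (arr σ A) i c) (proj₂ (cell-injective A A i j eq))))
    (λ ne → trans (rep .arrs A j) (sym (upd-other (arr σ A) {i = i} (λ i≡j → ne (cong (cell A) i≡j)))))
... | no A≢B rewrite ≢⇒≡ᵇ-false {toℕ A} {toℕ B} (λ eq → A≢B (toℕ-injective eq)) =
  trans (upd-other M (λ eq → A≢B (proj₁ (cell-injective A B i j eq)))) (rep .arrs B j)

-- The compiler and its correctness

tmp tmp′ : ℕ
tmp  = 30
tmp′ = 31

tmp-scratch : Scratch tmp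
tmp-scratch = ≤-refl , ≤ᵇ⇒≤ 31 32 tt

tmp′-scratch : Scratch tmp′
tmp′-scratch = ≤ᵇ⇒≤ 30 31 tt , ≤-refl

-- The machine cannot copy a cell directly: a variable is fetched by adding it to a zeroed cell.
compileOperand : ℕ → Operand → Program
compileOperand t (# c) = const t c
compileOperand t (‵ x) = const t 0 ⨾ add t t (toℕ x)

address : Arr → Program
address A =
  add tmp tmp tmp ⨾ add tmp tmp tmp ⨾ add tmp tmp tmp ⨾ add tmp tmp tmp ⨾
  const tmp′ (base A) ⨾ add tmp tmp tmp′

compileExpr : Expr → Program
compileExpr (val o)   = compileOperand tmp o
compileExpr (o ⊕ p)   = compileOperand tmp o ⨾ compileOperand tmp′ p ⨾ add tmp tmp tmp′
compileExpr (o ⊖ p)   = compileOperand tmp o ⨾ compileOperand tmp′ p ⨾ sub tmp tmp tmp′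
compileExpr (A ⟦ o ⟧) = compileOperand tmp o ⨾ address A ⨾ load tmp tmp

compile : Stmt → Program
compile nop                      = skip
compile (x := e)                  = compileExpr e ⨾ const tmp′ 0 ⨾ add (toℕ x) tmp tmp′
compile (A ⟦ o ⟧:= p)             =
  compileOperand tmp o ⨾ address A ⨾ compileOperand tmp′ p ⨾ store tmp tmp′
compile (p ؛ q)                  = compile p ⨾ compile q
compile (when x then p else q)   = ifPos (toℕ x) then compile p else compile q

-- An array read takes 2 + 6 + 1 operations and the copy into a variable 2 more; an array write
-- takes 2 + 6 + 2 + 1. A branch is charged for both arms.
size : Stmt → ℕ
size nop                     = 1
size (x := e)                 = 11
size (A ⟦ o ⟧:= p)            = 11
size (p ؛ q)                 = size p + size q
size (when x then p else q)  = suc (size p + size q)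

Runs : Program → Memory → ℕ → (Memory → Set) → Set
Runs p M c P = ∃[ t ] ∃[ M′ ] ⟨ p , M ⟩⇓⟨ t , M′ ⟩ × t ≤ c × P M′

Runs-seq : ∀ {p q M c d P Q} → Runs p M c P → (∀ {M′} → P M′ → Runs q M′ d Q) →
  Runs (p ⨾ q) M (c + d) Q
Runs-seq (_ , _ , exe , t≤c , P) f with f P
... | _ , _ , exe′ , t′≤d , Q = _ , _ , seq exe exe′ , +-mono-≤ t≤c t′≤d , Q

Runs-weaken : ∀ {p M c d P} → c ≤ d → Runs p M c P → Runs p M d P
Runs-weaken c≤d (t , M′ , exe , t≤c , P) = t , M′ , exe , ≤-trans t≤c c≤d , P

scratch≢ : ∀ {t} (x : Var) → Scratch t → t ≢ toℕ x
scratch≢ x (30≤t , _) refl = <⇒≱ (var<30 x) 30≤t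

-- The last clause keeps `tmp` intact while a second operand is evaluated into `tmp′`.
operand-runs : ∀ {M σ t} o → Scratch t → M Represents σ →
  Runs (compileOperand t o) M 2 (λ M′ →
    M′ Represents σ × M′ t ≡ ⟦ o ⟧ₒ σ × (∀ u → t ≢ u → M′ u ≡ M u))
operand-runs {M} {t = t} (# c) s rep =
  _ , _ , const , s≤s z≤n , scratch-invisible s rep , upd-same M t , λ u → upd-other M
operand-runs {M} {σ} {t} (‵ x) s rep =
  _ , _ , seq const add , ≤-refl , scratch-invisible s (scratch-invisible s rep)
  , trans (upd-same M′ t)
      (cong₂ _+_ (upd-same M t) (trans (upd-other M (scratch≢ x s)) (rep .vars x)))
  , λ u t≢u → trans (upd-other M′ t≢u) (upd-other M t≢u)
  where
  M′ : Memory
  M′ = M [ t ≔ 0 ]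

address-runs : ∀ {M σ} A i → M Represents σ → M tmp ≡ i →
  Runs (address A) M 6 (λ M′ → M′ Represents σ × M′ tmp ≡ cell A i)
address-runs {M} {σ} A i rep refl =
  _ , _ , seq add (seq add (seq add (seq add (seq const add)))) , ≤-refl
  , scratch-invisible tmp-scratch (scratch-invisible tmp′-scratch (tmps (tmps (tmps (tmps rep)))))
  , refl
  where
  tmps : ∀ {N c} → N Represents σ → N [ tmp ≔ c ] Represents σ
  tmps = scratch-invisible tmp-scratch

expr-runs : ∀ {M σ} e → M Represents σ →
  Runs (compileExpr e) M 9 (λ M′ → M′ Represents σ × M′ tmp ≡ ⟦ e ⟧ₑ σ)
expr-runs (val o) rep with operand-runs o tmp-scratch rep
... | _ , _ , exe , t≤2 , rep′ , v , _ = _ , _ , exe , ≤-trans t≤2 (≤ᵇ⇒≤ 2 9 tt) , rep′ , v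
expr-runs (o ⊕ p) rep with operand-runs o tmp-scratch rep
... | _ , _ , exe , t≤2 , rep′ , v , _ with operand-runs p tmp′-scratch rep′
... | _ , _ , exe′ , t′≤2 , rep″ , v′ , keep =
  _ , _ , seq exe (seq exe′ add)
  , ≤-trans (+-mono-≤ t≤2 (+-monoˡ-≤ 1 t′≤2)) (≤ᵇ⇒≤ 5 9 tt)
  , scratch-invisible tmp-scratch rep″ , cong₂ _+_ (trans (keep tmp λ ()) v) v′
expr-runs (o ⊖ p) rep with operand-runs o tmp-scratch rep
... | _ , _ , exe , t≤2 , rep′ , v , _ with operand-runs p tmp′-scratch rep′
... | _ , _ , exe′ , t′≤2 , rep″ , v′ , keep =
  _ , _ , seq exe (seq exe′ sub)
  , ≤-trans (+-mono-≤ t≤2 (+-monoˡ-≤ 1 t′≤2)) (≤ᵇ⇒≤ 5 9 tt)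
  , scratch-invisible tmp-scratch rep″ , cong₂ _∸_ (trans (keep tmp λ ()) v) v′
expr-runs (A ⟦ o ⟧) rep with operand-runs o tmp-scratch rep
... | _ , _ , exe , t≤2 , rep′ , v , _ with address-runs A _ rep′ v
... | _ , M″ , exe′ , t′≤6 , rep″ , v′ =
  _ , _ , seq exe (seq exe′ load)
  , +-mono-≤ t≤2 (+-monoˡ-≤ 1 t′≤6)
  , scratch-invisible tmp-scratch rep″ , trans (cong M″ v′) (rep″ .arrs A _)

compile-correct : ∀ s {M σ} → M Represents σ →
  Runs (compile s) M (size s) (_Represents exec s σ)
compile-correct nop rep = _ , _ , skip , ≤-refl , rep
compile-correct (x := e) {σ = σ} rep with expr-runs e rep
... | _ , M′ , exe , t≤9 , rep′ , v =
  _ , _ , seq exe (seq const add) , +-monoˡ-≤ 2 t≤9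
  , subst (λ c → _ Represents setVar σ x c) (trans (+-identityʳ _) v)
      (setVar-represents x (scratch-invisible tmp′-scratch rep′))
compile-correct (A ⟦ o ⟧:= p) {σ = σ} rep with operand-runs o tmp-scratch rep
... | _ , _ , exe , t≤2 , rep′ , v , _ with address-runs A _ rep′ v
... | _ , _ , exe′ , t′≤6 , rep″ , v′ with operand-runs p tmp′-scratch rep″
... | _ , M‴ , exe″ , t″≤2 , rep‴ , v″ , keep =
  _ , _ , seq exe (seq exe′ (seq exe″ store))
  , +-mono-≤ t≤2 (+-mono-≤ t′≤6 (+-monoˡ-≤ 1 t″≤2))
  , subst₂ (λ i c → (M‴ [ i ≔ c ]) Represents setArr σ A (⟦ o ⟧ₒ σ) (⟦ p ⟧ₒ σ))
      (sym (trans (keep tmp λ ()) v′)) (sym v″)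
      (setArr-represents A (⟦ o ⟧ₒ σ) rep‴)
compile-correct (p ؛ q) rep = Runs-seq (compile-correct p rep) (compile-correct q)
compile-correct (when x then p else q) {M} {σ} rep with var σ x in eq
... | zero with compile-correct q rep
...   | _ , _ , exe , t≤ , rep′ =
  _ , _ , if-zero (trans (rep .vars x) eq) exe , s≤s (≤-trans t≤ (m≤n+m _ _)) , rep′
compile-correct (when x then p else q) {M} {σ} rep | suc _ with compile-correct p rep
...   | _ , _ , exe , t≤ , rep′ =
  _ , _ , if-pos (subst (0 <_) (sym (trans (rep .vars x) eq)) z<s) exe
  , s≤s (≤-trans t≤ (m≤m+n _ _)) , rep′

while-correct : ∀ {x s σ k σ′ M} → Iterates x s σ k σ′ → M Represents σ →
  Runs (whilePos toℕ x run compile s) M (k * suc (size s) + 1) (_Represents σ′)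
while-correct {x} (stop eq) rep = _ , _ , while-zero (trans (rep .vars x) eq) , ≤-refl , rep
while-correct {x} {s} (next {k = k} pos it) rep with compile-correct s rep
... | _ , _ , exe , t≤ , rep′ with while-correct it rep′
... | _ , _ , exe′ , t′≤ , rep″ =
  _ , _ , while-pos (subst (0 <_) (sym (rep .vars x)) pos) exe exe′
  , s≤s (≤-trans (+-mono-≤ t≤ t′≤) (≤-reflexive (sym (+-assoc (size s) (k * suc (size s)) 1)))) , rep″

-- The algorithm

-- Vertices are numbered 1 to n and edges 1 to m, so that 0 can end every list.
-- Vertices are ordered by increasing LEVEL, then decreasing STAMP, then
-- decreasing RANK.  Within a level, vertices stamped EARLIER thus precede those
-- stamped LATER, and these precede all vertices with stamps from before the
-- insertion.

beginInsert searchBackward beginRaise searchForward link query : Stmt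

beginInsert =
  V := # 1 ⊕ ‵ X ؛ W := # 1 ⊕ ‵ Y ؛
  LATER := # 1 ⊕ ‵ CLOCK ؛ EARLIER := # 2 ⊕ ‵ CLOCK ؛
  HEIGHT := LEVEL ⟦ ‵ V ⟧ ؛
  BUDGET := # 1 ⊕ ‵ HEIGHT ؛
  -- Twice the budget plus one bounds the rounds: a scan costs one round and may push a vertex whose
  -- pop costs another, and v itself has to be popped. The same counter provides the decreasing
  -- ranks.
  FUEL := ‵ BUDGET ⊕ ‵ BUDGET ؛ FUEL := # 1 ⊕ ‵ FUEL ؛
  MARK ⟦ ‵ V ⟧:= ‵ LATER ؛
  TEST := INHEAD ⟦ ‵ V ⟧ ؛ CURSOR ⟦ ‵ V ⟧:= ‵ TEST ؛
  PARENT ⟦ ‵ V ⟧:= # 0 ؛ TOP := val (‵ V)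

searchBackward =
  FUEL := ‵ FUEL ⊖ # 1 ؛
  EDGE := CURSOR ⟦ ‵ TOP ⟧ ؛
  when EDGE then
    TEST := INNEXT ⟦ ‵ EDGE ⟧ ؛ CURSOR ⟦ ‵ TOP ⟧:= ‵ TEST ؛
    END := SOURCE ⟦ ‵ EDGE ⟧ ؛
    BUDGET := ‵ BUDGET ⊖ # 1 ؛
    when BUDGET then
      -- Positive exactly if the level of `END` is at least `HEIGHT`, hence equal to it, as levels
      -- do not decrease along arcs.
      TEST := LEVEL ⟦ ‵ END ⟧ ؛ TEST := # 1 ⊕ ‵ TEST ؛ TEST := ‵ TEST ⊖ ‵ HEIGHT ؛
      when TEST then
        TEST := MARK ⟦ ‵ END ⟧ ؛ TEST := ‵ LATER ⊖ ‵ TEST ؛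
        when TEST then
          MARK ⟦ ‵ END ⟧:= ‵ LATER ؛
          TEST := INHEAD ⟦ ‵ END ⟧ ؛ CURSOR ⟦ ‵ END ⟧:= ‵ TEST ؛
          PARENT ⟦ ‵ END ⟧:= ‵ TOP ؛ TOP := val (‵ END)
        else nop
      else nop
    -- The budget is spent; emptying the stack ends the loop, and stamps already given stay.
    else TOP := val (# 0)
  else
    -- `FUEL` decreases, so predecessors, which finish first, receive the larger ranks and precede.
    STAMP ⟦ ‵ TOP ⟧:= ‵ EARLIER ؛ RANK ⟦ ‵ TOP ⟧:= ‵ FUEL ؛
    TOP := PARENT ⟦ ‵ TOP ⟧

beginRaise =
  -- The difference is 1 exactly if the backward search was cut off, and this is the extra level.
  TEST := # 1 ⊖ ‵ BUDGET ؛ HEIGHT := ‵ TEST ⊕ ‵ HEIGHT ؛ COUNT := val (# 0) ؛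
  TEST := LEVEL ⟦ ‵ W ⟧ ؛ TEST := ‵ HEIGHT ⊖ ‵ TEST ؛
  when TEST then
    LEVEL ⟦ ‵ W ⟧:= ‵ HEIGHT ؛
    TEST := OUTHEAD ⟦ ‵ W ⟧ ؛ CURSOR ⟦ ‵ W ⟧:= ‵ TEST ؛
    PARENT ⟦ ‵ W ⟧:= # 0 ؛ TOP := val (‵ W)
  else nop

searchForward =
  EDGE := CURSOR ⟦ ‵ TOP ⟧ ؛
  when EDGE then
    TEST := OUTNEXT ⟦ ‵ EDGE ⟧ ؛ CURSOR ⟦ ‵ TOP ⟧:= ‵ TEST ؛
    END := TARGET ⟦ ‵ EDGE ⟧ ؛
    TEST := LEVEL ⟦ ‵ END ⟧ ؛ TEST := ‵ HEIGHT ⊖ ‵ TEST ؛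
    when TEST then
      LEVEL ⟦ ‵ END ⟧:= ‵ HEIGHT ؛
      TEST := OUTHEAD ⟦ ‵ END ⟧ ؛ CURSOR ⟦ ‵ END ⟧:= ‵ TEST ؛
      PARENT ⟦ ‵ END ⟧:= ‵ TOP ؛ TOP := val (‵ END)
    else nop
  else
    -- `COUNT` increases, so a vertex outranks its successors, which finish before it.
    STAMP ⟦ ‵ TOP ⟧:= ‵ LATER ؛ RANK ⟦ ‵ TOP ⟧:= ‵ COUNT ؛
    COUNT := # 1 ⊕ ‵ COUNT ؛
    TOP := PARENT ⟦ ‵ TOP ⟧

link =
  EDGES := # 1 ⊕ ‵ EDGES ؛
  SOURCE ⟦ ‵ EDGES ⟧:= ‵ V ؛ TARGET ⟦ ‵ EDGES ⟧:= ‵ W ؛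
  TEST := OUTHEAD ⟦ ‵ V ⟧ ؛ OUTNEXT ⟦ ‵ EDGES ⟧:= ‵ TEST ؛ OUTHEAD ⟦ ‵ V ⟧:= ‵ EDGES ؛
  TEST := INHEAD ⟦ ‵ W ⟧ ؛ INNEXT ⟦ ‵ EDGES ⟧:= ‵ TEST ؛ INHEAD ⟦ ‵ W ⟧:= ‵ EDGES ؛
  -- All stamps and marks are now at most `CLOCK`, so both stamps of the next insertion will be
  -- fresh.
  CLOCK := val (‵ EARLIER)

query =
  V := # 1 ⊕ ‵ X ؛ W := # 1 ⊕ ‵ Y ؛
  HEIGHT := LEVEL ⟦ ‵ V ⟧ ؛ TEST := LEVEL ⟦ ‵ W ⟧ ؛
  TOP := ‵ TEST ⊖ ‵ HEIGHT ؛
  when TOP then X := val (# 1) else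
  TOP := ‵ HEIGHT ⊖ ‵ TEST ؛
  when TOP then X := val (# 0) else
  HEIGHT := STAMP ⟦ ‵ V ⟧ ؛ TEST := STAMP ⟦ ‵ W ⟧ ؛
  TOP := ‵ HEIGHT ⊖ ‵ TEST ؛
  when TOP then X := val (# 1) else
  TOP := ‵ TEST ⊖ ‵ HEIGHT ؛
  when TOP then X := val (# 0) else
  HEIGHT := RANK ⟦ ‵ V ⟧ ؛ TEST := RANK ⟦ ‵ W ⟧ ؛
  X := ‵ HEIGHT ⊖ ‵ TEST

-- The part of the state that neither search changes
record Static : Set where
  constructor mkStatic
  field
    edges clock v w later earlier : ℕ
    source target inHead inNext outHead outNext : ℕ → ℕ

static : State → Static
static σ = mkStatic
  (var σ EDGES) (var σ CLOCK) (var σ V) (var σ W) (var σ LATER) (var σ EARLIER)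
  (arr σ SOURCE) (arr σ TARGET) (arr σ INHEAD) (arr σ INNEXT) (arr σ OUTHEAD) (arr σ OUTNEXT)

-- Linked lists, the order of the vertices and the stored graph

Chain : (ℕ → ℕ) → ℕ → List ℕ → Set
Chain nx h []       = h ≡ 0
Chain nx h (e ∷ es) = h ≡ e × 0 < e × Chain nx (nx e) es

chain-cong : ∀ {nx nx′ h} es → (∀ {e} → e ∈ es → nx e ≡ nx′ e) → Chain nx h es → Chain nx′ h es
chain-cong []       _    c             = c
chain-cong {nx} {nx′} (e ∷ es) same (eq , pos , c) =
  eq , pos , subst (λ h → Chain nx′ h es) (same (here refl)) (chain-cong es (λ i → same (there i)) c)

Before : (level stamp rank : ℕ → ℕ) → ℕ → ℕ → Set
Before level stamp rank x y = level x < level y ⊎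
  level x ≡ level y × (stamp y < stamp x ⊎ stamp y ≡ stamp x × rank y < rank x)

before⇒level≤ : ∀ {level stamp rank x y} → Before level stamp rank x y → level x ≤ level y
before⇒level≤ (inj₁ lt)       = <⇒≤ lt
before⇒level≤ (inj₂ (eq , _)) = ≤-reflexive eq

fuel-arc : ∀ {b l f} → 0 < b → b + b + l ≤ f → (b ∸ 1) + (b ∸ 1) + suc l ≤ f ∸ 1
fuel-arc {suc b} {l} _ (s≤s {n = f} le) =
  subst (_≤ f) (trans (cong (_+ l) (+-suc b b)) (sym (+-suc (b + b) l))) le

fuel-pop : ∀ {b l f} → b + b + suc l ≤ f → b + b + l ≤ f ∸ 1
fuel-pop {b} {l} le with ≤-trans (≤-reflexive (sym (+-suc (b + b) l))) le
... | s≤s le′ = le′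

InRange : ℕ → ℕ → Set
InRange n x = 0 < x × x ≤ n

-- `R` may exceed the stored arcs: during an insertion it already contains the new one.
record Graph (n m : ℕ) (ins outs : ℕ → List ℕ) (R : ℕ → ℕ → Set) (s : Static) : Set where
  open Static s
  field
    arc           : ∀ {e} → InRange m e → R (source e) (target e)
    source-range  : ∀ {e} → InRange m e → InRange n (source e)
    target-range  : ∀ {e} → InRange m e → InRange n (target e)
    ins-chain     : ∀ x → Chain inNext (inHead x) (ins x)
    ins-sound     : ∀ {e x} → e ∈ ins x → InRange m e × target e ≡ x
    ins-complete  : ∀ {e} → InRange m e → e ∈ ins (target e)
    ins-unique    : ∀ x → Unique (ins x)
    outs-chain    : ∀ x → Chain outNext (outHead x) (outs x)
    outs-sound    : ∀ {e x} → e ∈ outs x → InRange m e × source e ≡ x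
    outs-complete : ∀ {e} → InRange m e → e ∈ outs (source e)

vertices : List (ℕ × List ℕ) → List ℕ
vertices = map proj₁

-- The backward search

module Backward {n m : ℕ} {ins outs : ℕ → List ℕ} {R : ℕ → ℕ → Set}
  (acyclic : ∀ {x y} → R x y → Star R y x → ⊥)
  {s : Static} (G : Graph n m ins outs R s) (level : ℕ → ℕ) (k : ℕ)
  (later≡ : Static.later s ≡ 1 + Static.clock s) (earlier≡ : Static.earlier s ≡ 2 + Static.clock s)
  where

  open Static s
  open Graph G

  -- A vertex on the stack together with its incoming arcs not yet scanned.
  record Pending (mark cursor stamp : ℕ → ℕ) (scanned : List ℕ) (frame : ℕ × List ℕ) : Set where
    private
      x = proj₁ frame
      rest = proj₂ frame
    field
      level≡   : level x ≡ k
      marked   : mark x ≡ later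
      unplaced : stamp x ≢ earlier
      reaches  : Star R x v
      chain    : Chain inNext (cursor x) rest
      unique   : Unique rest
      subset   : All (λ e → e ∈ ins x × e ∉ scanned) rest
      others   : ∀ {e} → e ∈ ins x → e ∈ rest ⊎ (level (source e) ≡ k → mark (source e) ≡ later)

  -- The indices are the contents of the variables and arrays changed by the
  -- search; `scanned` lists the arcs paid for by the budget.
  record Invariant (top budget fuel : ℕ) (mark cursor parent stamp rank : ℕ → ℕ)
    (stack : List (ℕ × List ℕ)) (scanned : List ℕ) : Set where
    field
      chain    : Chain parent top (vertices stack)
      frames   : All (Pending mark cursor stamp scanned) stack
      paths    : AllPairs (λ x z → x ≢ z × Star R x z) (vertices stack)
      mark≤    : ∀ x → mark x ≤ later
      visited  : ∀ {x} → mark x ≡ later → x ∈ vertices stack ⊎ stamp x ≡ earlier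
      -- The ranks of finished vertices are at least the current fuel, so the next vertex to finish,
      -- with rank `fuel ∸ 1`, is ordered behind all of them.
      placed   : ∀ x → (stamp x ≡ earlier × Star R x v × level x ≡ k × mark x ≡ later × fuel ≤ rank x) ⊎ stamp x ≤ clock
      -- This is what makes it safe to stop at any moment without undoing stamps.
      closed   : ∀ {e} → InRange m e → stamp (target e) ≡ earlier → level (source e) ≡ k → stamp (source e) ≡ earlier
      sorted   : ∀ {e} → InRange m e → Before level stamp rank (source e) (target e)
      scanned! : Unique scanned
      scans    : All (λ e → InRange m e × level (target e) ≡ k × Star R (target e) v × mark (target e) ≡ later) scanned
      count    : length scanned + budget ≡ suc k
      enough   : budget + budget + length stack ≤ fuel
      start    : mark v ≡ later

  -- Order and stamps are as good after a cut-off as after a complete search; only `verdict` tells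
  -- the cases apart, and a cut-off yields the arcs that support level k + 1.
  record Outcome (top budget : ℕ) (mark stamp rank : ℕ → ℕ) : Set where
    field
      stopped : top ≡ 0
      mark≤   : ∀ x → mark x ≤ later
      placed  : ∀ x → (stamp x ≡ earlier × Star R x v) ⊎ stamp x ≤ clock
      sorted  : ∀ {e} → InRange m e → Before level stamp rank (source e) (target e)
      verdict : (0 < budget × stamp v ≡ earlier) ⊎
        (budget ≡ 0 × ∃[ es ] Unique es × length es ≡ suc k ×
          All (λ e → InRange m e × level (target e) ≡ k × Star R (target e) v) es)

  pending-cong : ∀ {mark mark′ cursor cursor′ stamp stamp′ scanned scanned′ z rest} →
    (∀ {y} → mark y ≡ later → mark′ y ≡ later) → cursor′ z ≡ cursor z → stamp′ z ≡ stamp z →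
    (∀ {e} → e ∈ ins z → e ∉ scanned → e ∉ scanned′) →
    Pending mark cursor stamp scanned (z , rest) → Pending mark′ cursor′ stamp′ scanned′ (z , rest)
  pending-cong mark⇒ cursor≡ stamp≡ fresh P = record
    { level≡ = level≡ ; marked = mark⇒ marked ; reaches = reaches ; unique = unique
    ; unplaced = λ eq → unplaced (trans (sym stamp≡) eq)
    ; chain = subst (λ h → Chain inNext h _) (sym cursor≡) chain
    ; subset = All.map (λ (i , j) → i , fresh i j) subset
    ; others = λ i → Sum.map₂ (λ f eq → mark⇒ (f eq)) (others i)
    }
    where open Pending P

  old≢earlier : ∀ {i} → i ≤ clock → i ≢ earlier
  old≢earlier i≤ refl = <⇒≱ (m≤n⇒m≤1+n ≤-refl) (subst (_≤ clock) earlier≡ i≤)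

  module _ {top budget fuel : ℕ} {mark cursor parent stamp rank : ℕ → ℕ} where

    finished : ∀ {scanned} → 0 < budget →
      Invariant top budget fuel mark cursor parent stamp rank [] scanned → Outcome top budget mark stamp rank
    finished 0<budget I = record
      { stopped = chain ; mark≤ = mark≤ ; sorted = sorted
      ; placed  = λ x → Sum.map₁ (λ (a , b , _) → a , b) (placed x)
      ; verdict = inj₁ (0<budget , [ (λ ()) , (λ eq → eq) ] (visited start))
      }
      where open Invariant I

    module _ {x e rest stack scanned}
      (I : Invariant top budget fuel mark cursor parent stamp rank ((x , e ∷ rest) ∷ stack) scanned) where

      open Invariant I
      open Pending (All.head frames) renaming (chain to chainₓ)

      private
        e∈ : e ∈ ins x
        e∈ = proj₁ (All.head subset)

        e-range : InRange m e
        e-range = proj₁ (ins-sound e∈)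

        e-target : target e ≡ x
        e-target = proj₂ (ins-sound e∈)

        scanned!′ : Unique (e ∷ scanned)
        scanned!′ = All.¬Any⇒All¬ scanned (proj₂ (All.head subset)) ∷ scanned!

        scans′ : All (λ e → InRange m e × level (target e) ≡ k × Star R (target e) v × mark (target e) ≡ later)
          (e ∷ scanned)
        scans′ = (e-range , trans (cong level e-target) level≡ ,
          subst (λ y → Star R y v) (sym e-target) reaches , trans (cong mark e-target) marked) ∷ scans

      source-level≤ : level (source e) ≤ k
      source-level≤ = ≤-trans (before⇒level≤ {level} {stamp} {rank} (sorted e-range))
        (≤-reflexive (trans (cong level e-target) level≡))

      -- The arc just scanned counts as well: a budget of 1 before the scan means k arcs in
      -- `scanned`, and `e` is the last of the k + 1.
      aborted : 0 < budget → budget ∸ 1 ≡ 0 → Outcome 0 (budget ∸ 1) mark stamp rank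
      aborted 0<b b≡ = record
        { stopped = refl ; mark≤ = mark≤ ; sorted = sorted
        ; placed  = λ x → Sum.map₁ (λ (a , b , _) → a , b) (placed x)
        ; verdict = inj₂ (b≡ , e ∷ scanned , scanned!′ ,
            trans (trans (+-comm 1 _) (cong (length scanned +_) (sym (≤-antisym (m∸n≡0⇒m≤n b≡) 0<b)))) count ,
            All.map (λ (a , b , c , _) → a , b , c) scans′)
        }

      private
        count′ : 0 < budget → suc (length scanned) + (budget ∸ 1) ≡ suc k
        count′ 0<b = trans (sym (+-suc (length scanned) (budget ∸ 1)))
          (trans (cong (length scanned +_) (m+[n∸m]≡n 0<b)) count)

        others-x : (level (source e) ≡ k → mark (source e) ≡ later) →
          ∀ {e′} → e′ ∈ ins x → e′ ∈ rest ⊎ (level (source e′) ≡ k → mark (source e′) ≡ later)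
        others-x ok i with others i
        ... | inj₁ (here refl) = inj₂ ok
        ... | inj₁ (there j)   = inj₁ j
        ... | inj₂ f           = inj₂ f

        subset-x : All (λ e′ → e′ ∈ ins x × e′ ∉ e ∷ scanned) rest
        subset-x with unique | subset
        ... | e∉ ∷ _ | _ ∷ sb = All.zipWith
          (λ { (ne , i , j) → i , λ { (here eq) → ne (sym eq) ; (there l) → j l } }) (e∉ , sb)

        fresh-z : ∀ {z} → x ≢ z → ∀ {e′} → e′ ∈ ins z → e′ ∉ scanned → e′ ∉ e ∷ scanned
        fresh-z x≢z i j (here refl) = x≢z (trans (sym e-target) (proj₂ (ins-sound i)))
        fresh-z x≢z i j (there l)   = j l

        placed′ : ∀ {mark′ : ℕ → ℕ} → (∀ {y} → mark y ≡ later → mark′ y ≡ later) → ∀ z →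
          (stamp z ≡ earlier × Star R z v × level z ≡ k × mark′ z ≡ later × fuel ∸ 1 ≤ rank z) ⊎ stamp z ≤ clock
        placed′ mark⇒ z =
          Sum.map₁ (λ (a , b , c , d , f) → a , b , c , mark⇒ {z} d , ≤-trans (m∸n≤m fuel 1) f) (placed z)

      passed : 0 < budget → (level (source e) ≡ k → mark (source e) ≡ later) →
        Invariant top (budget ∸ 1) (fuel ∸ 1) mark (upd cursor x (inNext e)) parent stamp rank
          ((x , rest) ∷ stack) (e ∷ scanned)
      passed 0<b ok = record
        { chain = chain ; paths = paths ; mark≤ = mark≤ ; visited = visited ; closed = closed
        ; sorted = sorted ; scanned! = scanned!′ ; scans = scans′ ; start = start
        ; placed = placed′ {mark} (λ eq → eq)
        ; count = count′ 0<b
        ; enough = ≤-trans (+-monoʳ-≤ (budget ∸ 1 + (budget ∸ 1)) (n≤1+n _)) (fuel-arc {budget} 0<b enough)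
        ; frames = top-frame ∷ All.tabulate frame
        }
        where
        top-frame : Pending mark (upd cursor x (inNext e)) stamp (e ∷ scanned) (x , rest)
        top-frame with unique
        ... | _ ∷ unique′ = record
          { level≡ = level≡ ; marked = marked ; reaches = reaches ; unplaced = unplaced
          ; unique = unique′
          ; chain = subst (λ h → Chain inNext h rest) (sym (upd-same cursor x)) (proj₂ (proj₂ chainₓ))
          ; subset = subset-x
          ; others = others-x ok
          }
        frame : ∀ {fr} → fr ∈ stack → Pending mark (upd cursor x (inNext e)) stamp (e ∷ scanned) fr
        frame i with paths
        ... | below ∷ _ = pending-cong (λ eq → eq) (upd-other cursor x≢z) refl (fresh-z x≢z)
          (All.lookup (All.tail frames) i)
          where x≢z = proj₁ (All.lookup below (∈-map⁺ proj₁ i))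

      pushed : 0 < budget → level (source e) ≡ k → mark (source e) < later →
        Invariant (source e) (budget ∸ 1) (fuel ∸ 1) (upd mark (source e) later)
          (upd (upd cursor x (inNext e)) (source e) (inHead (source e))) (upd parent (source e) top) stamp rank
          ((source e , ins (source e)) ∷ (x , rest) ∷ stack) (e ∷ scanned)
      pushed 0<b y-level y-unmarked = record
        { chain = refl , proj₁ (source-range e-range) ,
            subst (λ h → Chain parent′ h (x ∷ vertices stack)) (sym (upd-same parent y))
              (chain-cong (x ∷ vertices stack) (λ i → sym (upd-other parent (y≢stack i))) chain)
        ; paths = All.tabulate (λ i → y≢stack i , y-arc ◅ x-reaches i) ∷ paths
        ; mark≤ = λ z → upd-elim mark (_≤ later) y z (λ _ → ≤-refl) (λ _ → mark≤ z)
        ; visited = λ {z} → upd-elim mark (λ h → h ≡ later → z ∈ y ∷ x ∷ vertices stack ⊎ stamp z ≡ earlier) y z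
            (λ { refl _ → inj₁ (here refl) }) (λ _ eq → Sum.map₁ there (visited eq))
        ; closed = closed ; sorted = sorted ; scanned! = scanned!′
        ; scans = All.map (λ (a , b , c , d) → a , b , c , mark⇒ d) scans′
        ; start = mark⇒ start
        ; placed = placed′ {mark′} (λ {z} → mark⇒ {z})
        ; count = count′ 0<b
        ; enough = fuel-arc {budget} 0<b enough
        ; frames = y-frame ∷ top-frame ∷ All.tabulate frame
        }
        where
        y = source e
        mark′ = upd mark y later
        cursor′ = upd cursor x (inNext e)
        cursor″ = upd cursor′ y (inHead y)
        parent′ = upd parent y top
        y-arc : R y x
        y-arc = subst (R y) e-target (arc e-range)
        y-unscanned : ∀ {z} → mark z ≡ later → y ≢ z
        y-unscanned eq refl = <-irrefl eq y-unmarked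
        y≢x : y ≢ x
        y≢x = y-unscanned marked
        stack-marked : ∀ {fr} → fr ∈ stack → mark (proj₁ fr) ≡ later
        stack-marked i = Pending.marked (All.lookup (All.tail frames) i)
        y≢stack : ∀ {z} → z ∈ x ∷ vertices stack → y ≢ z
        y≢stack i with ∈-map⁻ proj₁ i
        ... | _ , j , refl = y-unscanned (Pending.marked (All.lookup frames j))
        x-reaches : ∀ {z} → z ∈ x ∷ vertices stack → Star R x z
        x-reaches (here refl) = ε
        x-reaches (there i) with paths
        ... | below ∷ _ = proj₂ (All.lookup below i)
        mark⇒ : ∀ {z} → mark z ≡ later → mark′ z ≡ later
        mark⇒ {z} eq = upd-elim mark (_≡ later) y z (λ _ → refl) (λ _ → eq)
        y-frame : Pending mark′ cursor″ stamp (e ∷ scanned) (y , ins y)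
        y-frame = record
          { level≡ = y-level ; marked = upd-same mark y ; reaches = y-arc ◅ reaches
          -- A finished vertex is marked, and y was not.
          ; unplaced = λ eq → [ (λ (_ , _ , _ , d , _) → y-unscanned d refl) , (λ old → old≢earlier old eq) ] (placed y)
          ; unique = ins-unique y
          ; chain = subst (λ h → Chain inNext h (ins y)) (sym (upd-same cursor′ y)) (ins-chain y)
          -- Every arc scanned so far ends in a marked vertex; y was unmarked, so none of its
          -- incoming arcs is among them.
          ; subset = All.tabulate (λ i → i , λ j → y-unscanned
              (subst (λ z → mark z ≡ later) (proj₂ (ins-sound i)) (proj₂ (proj₂ (proj₂ (All.lookup scans′ j))))) refl)
          ; others = inj₁
          }
        top-frame : Pending mark′ cursor″ stamp (e ∷ scanned) (x , rest)
        top-frame with unique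
        ... | _ ∷ unique′ = record
          { level≡ = level≡ ; marked = mark⇒ marked ; reaches = reaches ; unplaced = unplaced
          ; unique = unique′
          ; chain = subst (λ h → Chain inNext h rest)
              (sym (trans (upd-other cursor′ y≢x) (upd-same cursor x))) (proj₂ (proj₂ chainₓ))
          ; subset = subset-x
          ; others = others-y
          }
          where
          others-y : ∀ {e′} → e′ ∈ ins x → e′ ∈ rest ⊎ (level (source e′) ≡ k → mark′ (source e′) ≡ later)
          others-y i with others i
          ... | inj₁ (here refl) = inj₂ (λ _ → upd-same mark y)
          ... | inj₁ (there j)   = inj₁ j
          ... | inj₂ f           = inj₂ (λ eq → mark⇒ (f eq))
        frame : ∀ {fr} → fr ∈ stack → Pending mark′ cursor″ stamp (e ∷ scanned) fr
        frame i with paths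
        ... | below ∷ _ = pending-cong mark⇒
          (trans (upd-other cursor′ (y-unscanned (stack-marked i))) (upd-other cursor x≢z)) refl
          (fresh-z x≢z) (All.lookup (All.tail frames) i)
          where x≢z = proj₁ (All.lookup below (∈-map⁺ proj₁ i))

    module _ {x stack scanned}
      (I : Invariant top budget fuel mark cursor parent stamp rank ((x , []) ∷ stack) scanned) where

      open Invariant I
      open Pending (All.head frames) renaming (chain to chainₓ)

      -- With all arcs into x scanned, its predecessors of level k are marked, and by acyclicity
      -- finished, so x may be placed directly behind the finished vertices.
      placed-top : Invariant (parent x) budget (fuel ∸ 1) mark cursor parent
        (upd stamp x earlier) (upd rank x (fuel ∸ 1)) stack scanned
      placed-top = record
        { chain = proj₂ (proj₂ chain) ; paths = tail-paths ; mark≤ = mark≤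
        ; scanned! = scanned! ; scans = scans ; count = count ; start = start
        ; enough = fuel-pop {budget} enough
        ; frames = All.tabulate (λ i → pending-cong (λ eq → eq) refl (upd-other stamp (x≢below (∈-map⁺ proj₁ i)))
            (λ _ j → j) (All.lookup (All.tail frames) i))
        ; visited = visited′ ; placed = placed″ ; closed = closed′ ; sorted = sorted′
        }
        where
        stamp′ = upd stamp x earlier
        rank′ = upd rank x (fuel ∸ 1)
        tail-paths : AllPairs (λ x z → x ≢ z × Star R x z) (vertices stack)
        tail-paths with paths
        ... | _ ∷ p = p
        x≢below : ∀ {z} → z ∈ vertices stack → x ≢ z
        x≢below i with paths
        ... | below ∷ _ = proj₁ (All.lookup below i)
        x-reaches : ∀ {z} → z ∈ x ∷ vertices stack → Star R x z
        x-reaches (here refl) = ε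
        x-reaches (there i) with paths
        ... | below ∷ _ = proj₂ (All.lookup below i)
        visited′ : ∀ {z} → mark z ≡ later → z ∈ vertices stack ⊎ stamp′ z ≡ earlier
        visited′ {z} eq = upd-elim stamp (λ t → z ∈ vertices stack ⊎ t ≡ earlier) x z (λ _ → inj₂ refl) other
          where
          other : x ≢ z → z ∈ vertices stack ⊎ stamp z ≡ earlier
          other x≢z with visited eq
          ... | inj₁ (here refl) = ⊥-elim (x≢z refl)
          ... | inj₁ (there i)   = inj₁ i
          ... | inj₂ p           = inj₂ p
        placed″ : ∀ z →
          (stamp′ z ≡ earlier × Star R z v × level z ≡ k × mark z ≡ later × fuel ∸ 1 ≤ rank′ z) ⊎ stamp′ z ≤ clock
        placed″ z with x ≟ z
        ... | yes refl = inj₁ (upd-same stamp x , reaches , level≡ , marked , ≤-reflexive (sym (upd-same rank x)))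
        ... | no x≢z rewrite upd-other stamp {earlier} x≢z | upd-other rank {fuel ∸ 1} x≢z =
          Sum.map₁ (λ (a , b , c , d , f) → a , b , c , d , ≤-trans (m∸n≤m fuel 1) f) (placed z)
        -- A predecessor still on the stack would close a cycle.
        predecessor-placed : ∀ {e} → InRange m e → target e ≡ x → level (source e) ≡ k → stamp (source e) ≡ earlier
        predecessor-placed {e} e-range refl eq with others (ins-complete e-range)
        ... | inj₂ f with visited (f eq)
        ...   | inj₁ i = ⊥-elim (acyclic (arc e-range) (x-reaches i))
        ...   | inj₂ p = p
        closed′ : ∀ {e} → InRange m e → stamp′ (target e) ≡ earlier → level (source e) ≡ k → stamp′ (source e) ≡ earlier
        closed′ {e} e-range t≡ l≡ = upd-elim stamp (_≡ earlier) x (source e) (λ _ → refl) λ _ →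
          upd-elim stamp (λ t → t ≡ earlier → stamp (source e) ≡ earlier) x (target e)
            (λ x≡ _ → predecessor-placed e-range (sym x≡) l≡) (λ _ p → closed e-range p l≡) t≡
        sorted′ : ∀ {e} → InRange m e → Before level stamp′ rank′ (source e) (target e)
        sorted′ {e} e-range with sorted e-range
        ... | inj₁ lt = inj₁ lt
        ... | inj₂ (l≡ , lt) with x ≟ source e | x ≟ target e
        ...   | yes refl | yes eq = ⊥-elim (acyclic (arc e-range) (subst (λ z → Star R z x) eq ε))
        ...   | yes refl | no x≢t
                rewrite upd-same stamp x {earlier} | upd-other stamp {earlier} x≢t with placed (target e)
        -- Had the target been finished, `closed` would have x finished already.
        ...     | inj₁ (p , _) = ⊥-elim (unplaced (closed e-range p level≡))
        ...     | inj₂ old = inj₂ (l≡ , inj₁ (subst (stamp (target e) <_) (sym earlier≡) (s≤s (m≤n⇒m≤1+n old))))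
        sorted′ {e} e-range | inj₂ (l≡ , lt) | no x≢s | yes refl
                rewrite upd-same stamp x {earlier} | upd-other stamp {earlier} x≢s
                      | upd-same rank x {fuel ∸ 1} | upd-other rank {fuel ∸ 1} x≢s
                with predecessor-placed e-range refl (trans l≡ level≡)
        ...     | p with placed (source e)
        ...       | inj₂ old = ⊥-elim (old≢earlier old p)
        -- `enough` keeps `fuel` positive, so the truncated `fuel ∸ 1` is strictly below the rank of
        -- the source.
        ...       | inj₁ (_ , _ , _ , _ , fuel≤) =
                    inj₂ (l≡ , inj₂ (sym p , ≤-trans (fuel-step (≤-trans (m≤n+m 1 _) enough-x)) fuel≤))
          where
          enough-x : budget + budget + length stack + 1 ≤ fuel
          enough-x = ≤-trans (≤-reflexive (trans (+-comm _ 1) (sym (+-suc (budget + budget) _)))) enough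
          fuel-step : ∀ {f} → 1 ≤ f → f ∸ 1 < f
          fuel-step (s≤s _) = ≤-refl
        sorted′ {e} e-range | inj₂ (l≡ , lt) | no x≢s | no x≢t
                rewrite upd-other stamp {earlier} x≢t | upd-other stamp {earlier} x≢s
                      | upd-other rank {fuel ∸ 1} x≢t | upd-other rank {fuel ∸ 1} x≢s = inj₂ (l≡ , lt)

  initial : ∀ {mark cursor parent stamp rank} → 0 < v → level v ≡ k →
    (∀ x → mark x ≤ clock) → (∀ x → stamp x ≤ clock) →
    (∀ {e} → InRange m e → Before level stamp rank (source e) (target e)) →
    Invariant v (suc k) (suc (suc k + suc k)) (upd mark v later) (upd cursor v (inHead v))
      (upd parent v 0) stamp rank ((v , ins v) ∷ []) []
  initial {mark} {cursor} {parent} {stamp} 0<v v-level mark≤ stamp≤ sorted = record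
    { chain = refl , 0<v , upd-same parent v
    ; paths = [] ∷ []
    ; mark≤ = λ x → upd-elim mark (_≤ later) v x (λ _ → ≤-refl)
        (λ _ → ≤-trans (mark≤ x) (≤-trans (n≤1+n clock) (≤-reflexive (sym later≡))))
    ; visited = λ {x} → upd-elim mark (λ h → h ≡ later → x ∈ v ∷ [] ⊎ stamp x ≡ earlier) v x
        (λ eq _ → inj₁ (here (sym eq)))
        (λ _ eq → ⊥-elim (<⇒≱ (≤-reflexive (sym (trans eq later≡))) (mark≤ x)))
    ; placed = λ x → inj₂ (stamp≤ x)
    ; closed = λ {e} _ eq → ⊥-elim (old≢earlier (stamp≤ (target e)) eq)
    ; sorted = sorted
    ; scanned! = [] ; scans = [] ; count = refl
    ; enough = ≤-reflexive (+-comm _ 1)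
    ; start = upd-same mark v
    ; frames = record
        { level≡ = v-level ; marked = upd-same mark v ; unplaced = old≢earlier (stamp≤ v)
        ; reaches = ε ; chain = subst (λ h → Chain inNext h (ins v)) (sym (upd-same cursor v)) (ins-chain v)
        ; unique = ins-unique v ; subset = All.tabulate (λ i → i , λ ()) ; others = inj₁
        } ∷ []
    }

-- Sums over the vertices and the potential of the forward searches

sumTo : ℕ → (ℕ → ℕ) → ℕ
sumTo zero    f = 0
sumTo (suc n) f = f (suc n) + sumTo n f

sumTo-above : ∀ n {f g y} → n < y → (∀ x → y ≢ x → f x ≤ g x) → sumTo n f ≤ sumTo n g
sumTo-above zero    _   le = z≤n
sumTo-above (suc n) n<y le =
  +-mono-≤ (le (suc n) (>⇒≢ n<y)) (sumTo-above n (<-trans ≤-refl n<y) le)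

sumTo-drop : ∀ n {f g y c} → InRange n y → (∀ x → y ≢ x → f x ≤ g x) → f y + c ≤ g y →
  sumTo n f + c ≤ sumTo n g
sumTo-drop zero (0<y , y≤0) le drop = ⊥-elim (<⇒≱ 0<y y≤0)
sumTo-drop (suc n) {f} {g} {y} {c} (0<y , y≤) le drop with m≤n⇒m<n∨m≡n y≤
... | inj₁ (s≤s y≤n) = ≤-trans (≤-reflexive (+-assoc (f (suc n)) (sumTo n f) c))
  (+-mono-≤ (le (suc n) (<⇒≢ (s≤s y≤n))) (sumTo-drop n (0<y , y≤n) le drop))
... | inj₂ refl = ≤-trans
  (≤-reflexive (trans (+-assoc (f y) (sumTo n f) c)
    (trans (cong (f y +_) (+-comm (sumTo n f) c)) (sym (+-assoc (f y) c (sumTo n f))))))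
  (+-mono-≤ drop (sumTo-above n ≤-refl le))

sumTo-grow : ∀ n {f g y c} → (∀ x → y ≢ x → g x ≤ f x) → g y ≤ f y + c →
  sumTo n g ≤ sumTo n f + c
sumTo-grow zero le grow = z≤n
sumTo-grow (suc n) {f} {g} {y} {c} le grow with y ≟ suc n
... | no y≢ = ≤-trans (+-mono-≤ (le (suc n) y≢) (sumTo-grow n le grow))
  (≤-reflexive (sym (+-assoc (f (suc n)) (sumTo n f) c)))
... | yes refl = ≤-trans (+-mono-≤ grow (sumTo-above n ≤-refl le))
  (≤-reflexive (trans (+-assoc (f y) c (sumTo n f))
    (trans (cong (f y +_) (+-comm c (sumTo n f))) (sym (+-assoc (f y) (sumTo n f) c)))))

-- Each vertex x can still be raised S ∸ level x times, and every time the
-- search scans its outgoing arcs.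
deficit : ℕ → (ℕ → List ℕ) → ℕ → (ℕ → ℕ) → ℕ
deficit S outs n level = sumTo n (λ x → (S ∸ level x) * suc (length (outs x)))

-- One level gained releases the weight of y at least once, which is the price of scanning its
-- outgoing arcs and popping it.
deficit-raise : ∀ {S n y h level} outs → InRange n y → level y < h → h ≤ S →
  deficit S outs n (upd level y h) + suc (length (outs y)) ≤ deficit S outs n level
deficit-raise {S} {n} {y} {h} {level} outs y-range y<h h≤S =
  sumTo-drop n y-range
    (λ x y≢x → ≤-reflexive (cong (λ l → (S ∸ l) * suc (length (outs x))) (upd-other level y≢x)))
    (subst (λ l → (S ∸ l) * d + d ≤ (S ∸ level y) * d) (sym (upd-same level y))
      (≤-trans (≤-reflexive (+-comm _ d)) (*-monoˡ-≤ d (∸-monoʳ-< y<h h≤S))))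
  where d = suc (length (outs y))

-- The rounds still owed to the stack: one for each unscanned arc and one for each pop.
remaining : List (ℕ × List ℕ) → ℕ
remaining []                  = 0
remaining ((_ , rest) ∷ stack) = suc (length rest) + remaining stack

-- The forward search

module Forward {n m : ℕ} {ins outs : ℕ → List ℕ} {R : ℕ → ℕ → Set}
  (acyclic : ∀ {x y} → R x y → Star R y x → ⊥)
  {s : Static} (G : Graph n m ins outs R s) (level₀ stamp₀ : ℕ → ℕ) (S height : ℕ)
  (vw : R (Static.v s) (Static.w s)) (height≤S : height ≤ S)
  (later≡ : Static.later s ≡ 1 + Static.clock s) (earlier≡ : Static.earlier s ≡ 2 + Static.clock s)
  where

  open Static s
  open Graph G

  record Pending (level cursor : ℕ → ℕ) (frame : ℕ × List ℕ) : Set where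
    private
      x = proj₁ frame
      rest = proj₂ frame
    field
      level≡   : level x ≡ height
      range    : InRange n x
      reached  : Star R w x
      chain    : Chain outNext (cursor x) rest
      subset   : All (_∈ outs x) rest
      others   : ∀ {e} → e ∈ outs x → e ∈ rest ⊎ height ≤ level (target e)

  record Invariant (top count : ℕ) (level cursor parent stamp rank : ℕ → ℕ)
    (stack : List (ℕ × List ℕ)) (bound : ℕ) : Set where
    field
      chain   : Chain parent top (vertices stack)
      frames  : All (Pending level cursor) stack
      paths   : AllPairs (λ x z → x ≢ z × Star R z x) (vertices stack)
      levels  : ∀ x → level x ≡ level₀ x ⊎ (level₀ x < height × level x ≡ height × Star R w x)
      -- An arc out of a stacked vertex may be out of order, as the new key is not yet complete. For
      -- an arc into a stacked vertex the strict inequality of levels makes the coming change of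
      -- stamp and rank harmless.
      sorted  : ∀ {e} → InRange m e → source e ∈ vertices stack ⊎
        (Before level stamp rank (source e) (target e) × (target e ∈ vertices stack → level (source e) < height))
      placed  : ∀ x → stamp x ≤ clock ⊎ (stamp x ≡ later × rank x < count) ⊎ (stamp x ≡ earlier × Star R x v)
      -- Needed for v: it is unreachable from w and so keeps the stamp of the backward search.
      origin  : ∀ x → ¬ Star R w x → stamp x ≡ stamp₀ x
      raised  : height ≤ level w
      potential : deficit S outs n level + remaining stack ≤ bound

  pending-cong : ∀ {level level′ cursor cursor′ z rest} →
    (∀ {x} → height ≤ level x → height ≤ level′ x) → level′ z ≡ level z → cursor′ z ≡ cursor z →
    Pending level cursor (z , rest) → Pending level′ cursor′ (z , rest)
  pending-cong level⇒ lev≡ cursor≡ P = record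
    { level≡ = trans lev≡ level≡ ; range = range ; reached = reached ; subset = subset
    ; chain = subst (λ h → Chain outNext h _) (sym cursor≡) chain
    ; others = λ i → Sum.map₂ level⇒ (others i)
    }
    where open Pending P

  record Outcome (bound : ℕ) (level stamp rank : ℕ → ℕ) : Set where
    field
      levels  : ∀ x → level x ≡ level₀ x ⊎ (level₀ x < height × level x ≡ height × Star R w x)
      sorted  : ∀ {e} → InRange m e → Before level stamp rank (source e) (target e)
      placed  : ∀ x → stamp x ≤ clock ⊎ (stamp x ≡ later) ⊎ (stamp x ≡ earlier × Star R x v)
      origin  : ∀ x → ¬ Star R w x → stamp x ≡ stamp₀ x
      raised  : height ≤ level w
      potential : deficit S outs n level ≤ bound

  module _ {top count bound : ℕ} {level cursor parent stamp rank : ℕ → ℕ} where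

    finished : Invariant top count level cursor parent stamp rank [] bound →
      Outcome bound level stamp rank
    finished I = record
      { levels = levels ; origin = origin ; raised = raised
      ; sorted = λ r → [ (λ ()) , proj₁ ] (sorted r)
      ; placed = λ x → Sum.map₂ (Sum.map₁ proj₁) (placed x)
      ; potential = ≤-trans (m≤m+n _ 0) potential
      }
      where open Invariant I

    module _ {x e rest stack}
      (I : Invariant top count level cursor parent stamp rank ((x , e ∷ rest) ∷ stack) (suc bound)) where

      open Invariant I
      open Pending (All.head frames) renaming (chain to chainₓ)

      private
        e-range : InRange m e
        e-range = proj₁ (outs-sound (All.head subset))

        e-source : source e ≡ x
        e-source = proj₂ (outs-sound (All.head subset))

        below : ∀ {z} → z ∈ vertices stack → x ≢ z × Star R z x
        below i with paths
        ... | b ∷ _ = All.lookup b i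

      passed : height ≤ level (target e) →
        Invariant top count level (upd cursor x (outNext e)) parent stamp rank ((x , rest) ∷ stack) bound
      passed ok = record
        { chain = chain ; paths = paths ; levels = levels ; sorted = sorted
        ; placed = placed ; origin = origin ; raised = raised
        ; potential = s≤s⁻¹ (≤-trans (≤-reflexive (sym (+-suc (deficit S outs n level) _))) potential)
        ; frames = record
            { level≡ = level≡ ; range = range ; reached = reached ; subset = All.tail subset
            ; chain = subst (λ h → Chain outNext h rest) (sym (upd-same cursor x)) (proj₂ (proj₂ chainₓ))
            ; others = others′
            } ∷ All.tabulate (λ i → pending-cong (λ le → le) refl
                (upd-other cursor (proj₁ (below (∈-map⁺ proj₁ i)))) (All.lookup (All.tail frames) i))
        }
        where
        others′ : ∀ {e′} → e′ ∈ outs x → e′ ∈ rest ⊎ height ≤ level (target e′)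
        others′ i with others i
        ... | inj₁ (here refl) = inj₂ ok
        ... | inj₁ (there j)   = inj₁ j
        ... | inj₂ le          = inj₂ le

      pushed : level (target e) < height →
        Invariant (target e) count (upd level (target e) height)
          (upd (upd cursor x (outNext e)) (target e) (outHead (target e))) (upd parent (target e) top)
          stamp rank ((target e , outs (target e)) ∷ (x , rest) ∷ stack) bound
      pushed y<h = record
        { chain = refl , proj₁ y-range ,
            subst (λ h → Chain parent′ h (x ∷ vertices stack)) (sym (upd-same parent y))
              (chain-cong (x ∷ vertices stack) (λ i → sym (upd-other parent (y≢stack i))) chain)
        ; paths = All.tabulate (λ i → y≢stack i , reaches-x i ◅◅ y-arc ◅ ε) ∷ paths
        ; levels = levels′ ; sorted = sorted′ ; placed = placed ; origin = origin ; raised = level⇒ raised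
        ; potential = potential′
        ; frames = record
            { level≡ = upd-same level y ; range = y-range ; reached = reached ◅◅ y-arc ◅ ε
            ; chain = subst (λ h → Chain outNext h (outs y)) (sym (upd-same cursor′ y)) (outs-chain y)
            ; subset = All.tabulate (λ i → i) ; others = inj₁
            } ∷ record
            { level≡ = trans (upd-other level y≢x) level≡ ; range = range ; reached = reached
            ; chain = subst (λ h → Chain outNext h rest)
                (sym (trans (upd-other cursor′ y≢x) (upd-same cursor x))) (proj₂ (proj₂ chainₓ))
            ; subset = All.tail subset
            ; others = others′
            } ∷ All.tabulate (λ i → let j = ∈-map⁺ proj₁ i in
                pending-cong level⇒ (upd-other level (y≢stack (there j)))
                  (trans (upd-other cursor′ (y≢stack (there j))) (upd-other cursor (proj₁ (below j))))
                  (All.lookup (All.tail frames) i))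
        }
        where
        y = target e
        level′ = upd level y height
        cursor′ = upd cursor x (outNext e)
        parent′ = upd parent y top
        y-range : InRange n y
        y-range = target-range e-range
        y-arc : R x y
        y-arc = subst (λ z → R z y) e-source (arc e-range)
        y≢stack : ∀ {z} → z ∈ x ∷ vertices stack → y ≢ z
        y≢stack i refl with ∈-map⁻ proj₁ i
        ... | _ , j , eq = <-irrefl (trans (cong level eq) (Pending.level≡ (All.lookup frames j))) y<h
        y≢x : y ≢ x
        y≢x = y≢stack (here refl)
        reaches-x : ∀ {z} → z ∈ x ∷ vertices stack → Star R z x
        reaches-x (here refl) = ε
        reaches-x (there i)   = proj₂ (below i)
        level⇒ : ∀ {z} → height ≤ level z → height ≤ level′ z
        level⇒ {z} le = upd-elim level (height ≤_) y z (λ _ → ≤-refl) (λ _ → le)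
        others′ : ∀ {e′} → e′ ∈ outs x → e′ ∈ rest ⊎ height ≤ level′ (target e′)
        others′ i with others i
        ... | inj₁ (here refl) = inj₂ (≤-reflexive (sym (upd-same level y)))
        ... | inj₁ (there j)   = inj₁ j
        ... | inj₂ le          = inj₂ (level⇒ le)
        levels′ : ∀ z → level′ z ≡ level₀ z ⊎ (level₀ z < height × level′ z ≡ height × Star R w z)
        levels′ z with y ≟ z
        ... | no y≢z rewrite upd-other level {height} y≢z = levels z
        ... | yes refl with levels y
        ...   | inj₁ eq = inj₂ (subst (_< height) eq y<h , upd-same level y , reached ◅◅ y-arc ◅ ε)
        ...   | inj₂ (_ , eq , _) = ⊥-elim (<-irrefl eq y<h)
        sorted′ : ∀ {e′} → InRange m e′ → source e′ ∈ y ∷ x ∷ vertices stack ⊎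
          (Before level′ stamp rank (source e′) (target e′) ×
            (target e′ ∈ y ∷ x ∷ vertices stack → level′ (source e′) < height))
        sorted′ {e′} r with y ≟ source e′
        ... | yes eq = inj₁ (here (sym eq))
        ... | no y≢s with sorted r
        ...   | inj₁ i = inj₁ (there i)
        ...   | inj₂ (bef , low) with y ≟ target e′
        ...     | yes eq rewrite upd-other level {height} y≢s | sym eq | upd-same level y {height} =
                    inj₂ (inj₁ s<h , λ _ → s<h)
          where
          -- The source lay no higher than y did before the raise, which turns the order of the arc
          -- into a strict inequality of levels.
          s<h : level (source e′) < height
          s<h = ≤-<-trans (before⇒level≤ {level} {stamp} {rank} bef) y<h
        ...     | no y≢t rewrite upd-other level {height} y≢s | upd-other level {height} y≢t =
                    inj₂ (bef , λ { (here eq) → ⊥-elim (y≢t (sym eq)) ; (there i) → low i })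
        -- The new frame adds to `remaining` the weight that the deficit gives up, and the scanned
        -- arc pays for this round.
        potential′ : deficit S outs n level′ + (suc (length (outs y)) + (suc (length rest) + remaining stack)) ≤ bound
        potential′ = s≤s⁻¹ (begin
          suc (deficit S outs n level′ + (suc (length (outs y)) + (suc (length rest) + remaining stack)))
            ≡⟨ cong suc (+-assoc (deficit S outs n level′) _ _) ⟨
          suc (deficit S outs n level′ + suc (length (outs y)) + (suc (length rest) + remaining stack))
            ≤⟨ s≤s (+-monoˡ-≤ _ (deficit-raise {level = level} outs y-range y<h height≤S)) ⟩
          suc (deficit S outs n level + (suc (length rest) + remaining stack))
            ≡⟨ +-suc (deficit S outs n level) _ ⟨
          deficit S outs n level + suc (suc (length rest) + remaining stack)
            ≤⟨ potential ⟩
          suc bound ∎)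
          where open ≤-Reasoning

    module _ {x stack}
      (I : Invariant top count level cursor parent stamp rank ((x , []) ∷ stack) (suc bound)) where

      open Invariant I
      open Pending (All.head frames) renaming (chain to chainₓ)

      placed-top : Invariant (parent x) (suc count) level cursor parent
        (upd stamp x later) (upd rank x count) stack bound
      placed-top = record
        { chain = proj₂ (proj₂ chain) ; levels = levels ; raised = raised
        ; paths = tail-paths
        ; frames = All.tabulate (λ i → pending-cong (λ le → le) refl refl (All.lookup (All.tail frames) i))
        ; potential = s≤s⁻¹ (≤-trans (≤-reflexive (sym (+-suc (deficit S outs n level) _))) potential)
        ; origin = λ z unreached → trans (upd-other stamp {i = x} (λ { refl → unreached reached })) (origin z unreached)
        ; placed = placed′ ; sorted = sorted′
        }
        where
        stamp′ = upd stamp x later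
        rank′ = upd rank x count
        tail-paths : AllPairs (λ x z → x ≢ z × Star R z x) (vertices stack)
        tail-paths with paths
        ... | _ ∷ p = p
        reaches-x : ∀ {z} → z ∈ x ∷ vertices stack → Star R z x
        reaches-x (here refl) = ε
        reaches-x (there i) with paths
        ... | b ∷ _ = proj₂ (All.lookup b i)
        placed′ : ∀ z → stamp′ z ≤ clock ⊎ (stamp′ z ≡ later × rank′ z < suc count) ⊎ (stamp′ z ≡ earlier × Star R z v)
        placed′ z with x ≟ z
        ... | yes refl = inj₂ (inj₁ (upd-same stamp x , s≤s (≤-reflexive (upd-same rank x))))
        ... | no x≢z rewrite upd-other stamp {later} x≢z | upd-other rank {count} x≢z =
          Sum.map₂ (Sum.map₁ (λ (a , b) → a , m≤n⇒m≤1+n b)) (placed z)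
        -- A successor stamped `earlier` would reach v and close a cycle through w and x. Any other
        -- successor has an older stamp or finished before with a smaller rank.
        key : ∀ {y} → R x y → stamp y < later ⊎ stamp y ≡ later × rank y < count
        key {y} xy with placed y
        ... | inj₁ old = inj₁ (subst (stamp y <_) (sym later≡) (s≤s old))
        ... | inj₂ (inj₁ p) = inj₂ p
        ... | inj₂ (inj₂ (_ , yv)) = ⊥-elim (acyclic xy (yv ◅◅ vw ◅ reached))
        sorted′ : ∀ {e} → InRange m e → source e ∈ vertices stack ⊎
          (Before level stamp′ rank′ (source e) (target e) × (target e ∈ vertices stack → level (source e) < height))
        sorted′ {e} r with x ≟ source e
        ... | yes refl = inj₂ (from-x (m≤n⇒m<n∨m≡n ([ (λ ()) , (λ le → le) ] (others (outs-complete r))))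
                              , λ i → ⊥-elim (no-cycle (there i)))
          where
          no-cycle : target e ∉ x ∷ vertices stack
          no-cycle i = acyclic (arc r) (reaches-x i)
          from-x : height < level (target e) ⊎ height ≡ level (target e) → Before level stamp′ rank′ x (target e)
          from-x (inj₁ lt) = inj₁ (subst (_< level (target e)) (sym level≡) lt)
          from-x (inj₂ eq)
            rewrite upd-same stamp x {later} | upd-same rank x {count}
                  | upd-other stamp {later} {x} {target e} (λ eq → no-cycle (here (sym eq)))
                  | upd-other rank {count} {x} {target e} (λ eq → no-cycle (here (sym eq))) =
            inj₂ (trans level≡ eq , key (arc r))
        ... | no x≢s with sorted r
        ...   | inj₁ (here eq) = ⊥-elim (x≢s (sym eq))
        ...   | inj₁ (there i) = inj₁ i
        ...   | inj₂ (bef , low) with x ≟ target e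
        ...     | yes eq = inj₂ (inj₁ (subst (level (source e) <_) (trans (sym level≡) (cong level eq))
                                                (low (here (sym eq))))
                                 , λ i → low (there i))
        ...     | no x≢t
                  rewrite upd-other stamp {later} x≢s | upd-other stamp {later} x≢t
                        | upd-other rank {count} x≢s | upd-other rank {count} x≢t = inj₂ (bef , λ i → low (there i))

  module _ {cursor parent rank : ℕ → ℕ}
    (sorted₀ : ∀ {e} → InRange m e → Before level₀ stamp₀ rank (source e) (target e))
    (placed₀ : ∀ x → (stamp₀ x ≡ earlier × Star R x v) ⊎ stamp₀ x ≤ clock) where

    private
      placed′ : ∀ x → stamp₀ x ≤ clock ⊎ (stamp₀ x ≡ later × rank x < 0) ⊎ (stamp₀ x ≡ earlier × Star R x v)
      placed′ x = [ (λ p → inj₂ (inj₂ p)) , inj₁ ] (placed₀ x)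

    initial-idle : ∀ {top} → top ≡ 0 → height ≤ level₀ w →
      Invariant top 0 level₀ cursor parent stamp₀ rank [] (deficit S outs n level₀)
    initial-idle top≡0 raised = record
      { raised = raised ; chain = top≡0 ; frames = [] ; paths = [] ; levels = λ _ → inj₁ refl
      ; sorted = λ r → inj₂ (sorted₀ r , λ ()) ; placed = placed′ ; origin = λ _ _ → refl
      ; potential = ≤-reflexive (+-identityʳ _)
      }

    initial : InRange n w → level₀ w < height →
      Invariant w 0 (upd level₀ w height) (upd cursor w (outHead w)) (upd parent w 0) stamp₀ rank
        ((w , outs w) ∷ []) (deficit S outs n level₀)
    initial w-range w<h = record
      { chain = refl , proj₁ w-range , upd-same parent w
      ; paths = [] ∷ []
      ; placed = placed′ ; origin = λ _ _ → refl ; raised = ≤-reflexive (sym (upd-same level₀ w))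
      ; frames = record
          { level≡ = upd-same level₀ w ; range = w-range ; reached = ε
          ; chain = subst (λ h → Chain outNext h (outs w)) (sym (upd-same cursor w)) (outs-chain w)
          ; subset = All.tabulate (λ i → i) ; others = inj₁
          } ∷ []
      ; potential = ≤-trans (≤-reflexive (cong (deficit S outs n level₁ +_) (+-identityʳ _)))
          (deficit-raise {level = level₀} outs w-range w<h height≤S)
      ; levels = levels′ ; sorted = sorted′
      }
      where
      level₁ = upd level₀ w height
      levels′ : ∀ z → level₁ z ≡ level₀ z ⊎ (level₀ z < height × level₁ z ≡ height × Star R w z)
      levels′ z with w ≟ z
      ... | yes refl = inj₂ (w<h , upd-same level₀ w , ε)
      ... | no w≢z   = inj₁ (upd-other level₀ w≢z)
      sorted′ : ∀ {e} → InRange m e → source e ∈ w ∷ [] ⊎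
        (Before level₁ stamp₀ rank (source e) (target e) × (target e ∈ w ∷ [] → level₁ (source e) < height))
      sorted′ {e} r with w ≟ source e
      ... | yes eq = inj₁ (here (sym eq))
      ... | no w≢s with w ≟ target e
      ...   | no w≢t rewrite upd-other level₀ {height} w≢s | upd-other level₀ {height} w≢t =
                inj₂ (sorted₀ r , λ { (here eq) → ⊥-elim (w≢t (sym eq)) })
      ...   | yes eq rewrite upd-other level₀ {height} w≢s | sym eq | upd-same level₀ w {height} =
                inj₂ (inj₁ s<h , λ _ → s<h)
        where
        s<h : level₀ (source e) < height
        s<h = ≤-<-trans (before⇒level≤ {level₀} {stamp₀} {rank} (sorted₀ r)) (subst (λ z → level₀ z < height) eq w<h)

-- What the two searches leave unchanged

backwardFrame forwardFrame : State → Static × ℕ × (ℕ → ℕ)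
backwardFrame σ = static σ , var σ HEIGHT , arr σ LEVEL
forwardFrame σ  = static σ , var σ HEIGHT , arr σ MARK

-- The two loops run on states

module _ {n m : ℕ} {ins outs : ℕ → List ℕ} {R : ℕ → ℕ → Set}
  (acyclic : ∀ {x y} → R x y → Star R y x → ⊥) where

  BackwardInvariant : (σ : State) → Graph n m ins outs R (static σ) →
    var σ LATER ≡ 1 + var σ CLOCK → var σ EARLIER ≡ 2 + var σ CLOCK →
    List (ℕ × List ℕ) → List ℕ → Set
  BackwardInvariant σ G later≡ earlier≡ =
    Backward.Invariant acyclic {static σ} G (arr σ LEVEL) (var σ HEIGHT) later≡ earlier≡
      (var σ TOP) (var σ BUDGET) (var σ FUEL) (arr σ MARK) (arr σ CURSOR) (arr σ PARENT) (arr σ STAMP) (arr σ RANK)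

  BackwardOutcome : (σ : State) → Graph n m ins outs R (static σ) →
    var σ LATER ≡ 1 + var σ CLOCK → var σ EARLIER ≡ 2 + var σ CLOCK → Set
  BackwardOutcome σ G later≡ earlier≡ =
    Backward.Outcome acyclic {static σ} G (arr σ LEVEL) (var σ HEIGHT) later≡ earlier≡
      (var σ TOP) (var σ BUDGET) (arr σ MARK) (arr σ STAMP) (arr σ RANK)

  -- The final state brings its own graph and clock equations, so `outcome` needs no transport along
  -- `frame`.
  record BackwardResult (σ : State) (fuel : ℕ) : Set where
    constructor result
    field
      {final}      : State
      {iterations} : ℕ
      run-loop     : Iterates TOP searchBackward σ iterations final
      iterations≤  : iterations ≤ fuel
      frame        : backwardFrame final ≡ backwardFrame σ
      {graph}      : Graph n m ins outs R (static final)
      {later≡}     : var final LATER ≡ 1 + var final CLOCK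
      {earlier≡}   : var final EARLIER ≡ 2 + var final CLOCK
      outcome      : BackwardOutcome final graph later≡ earlier≡

  -- Induction on a bound for `FUEL`, which `enough` keeps from running dry while a vertex is
  -- stacked. The budget stays positive because the round that exhausts it ends the loop.
  backward-loop : ∀ fuel σ G later≡ earlier≡ {stack scanned} → 0 < var σ BUDGET →
    BackwardInvariant σ G later≡ earlier≡ stack scanned → var σ FUEL ≤ fuel → BackwardResult σ fuel
  backward-loop fuel σ G l≡ e≡ {[]} budget I _ =
    result (stop I.chain) z≤n refl (Backward.finished acyclic G _ _ l≡ e≡ budget I)
    where module I = Backward.Invariant I
  backward-loop zero σ G l≡ e≡ {_ ∷ _} budget I fuel≤ = ⊥-elim (<⇒≱ (begin
    1                                                ≤⟨ s≤s z≤n ⟩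
    suc _                                            ≤⟨ m≤n+m _ (var σ BUDGET + var σ BUDGET) ⟩
    _                                                ≤⟨ I.enough ⟩
    var σ FUEL                                       ∎) fuel≤)
    where
    module I = Backward.Invariant I
    open ≤-Reasoning
  backward-loop (suc fuel) σ G l≡ e≡ {(x , rest) ∷ stack} budget I fuel≤
    with Backward.Invariant.chain I
  ... | refl , 0<top , _ = one-more (step rest I)
    where
    module B = Backward acyclic G (arr σ LEVEL) (var σ HEIGHT) l≡ e≡
    After : State → Set
    After τ = backwardFrame τ ≡ backwardFrame σ × BackwardResult τ fuel
    one-more : After (exec searchBackward σ) → BackwardResult σ (suc fuel)
    one-more (frame′ , result it i≤ frame outcome) =
      result (next 0<top it) (s≤s i≤) (trans frame frame′) outcome
    fuel≤′ : var σ FUEL ∸ 1 ≤ fuel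
    fuel≤′ = ∸-monoˡ-≤ 1 fuel≤
    step : ∀ rest {scanned} → BackwardInvariant σ G l≡ e≡ ((var σ TOP , rest) ∷ stack) scanned →
      After (exec searchBackward σ)
    step [] I = select-elim After (arr σ CURSOR (var σ TOP))
      (λ pos → ⊥-elim (<-irrefl (sym (B.Pending.chain (All.head (B.Invariant.frames I)))) pos))
      (λ _ → refl , backward-loop fuel _ G l≡ e≡ budget (B.placed-top I) fuel≤′)
    step (e ∷ rest) I with B.Pending.chain (All.head (B.Invariant.frames I))
    ... | refl , 0<e , _ = select-elim After e
      (λ _ → select-elim After (var σ BUDGET ∸ 1)
        (λ budget′ → select-elim After (1 + arr σ LEVEL (arr σ SOURCE e) ∸ var σ HEIGHT)
          (λ test → let level≡ = ≤-antisym (B.source-level≤ I) (s≤s⁻¹ (m∸n≢0⇒n<m (>⇒≢ test))) in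
            select-elim After (var σ LATER ∸ arr σ MARK (arr σ SOURCE e))
            (λ unmarked → refl , backward-loop fuel _ G l≡ e≡ budget′
              (B.pushed I budget level≡ (m∸n≢0⇒n<m (>⇒≢ unmarked))) fuel≤′)
            (λ marked → refl , backward-loop fuel _ G l≡ e≡ budget′
              (B.passed I budget (λ _ → ≤-antisym (B.Invariant.mark≤ I _) (m∸n≡0⇒m≤n marked))) fuel≤′))
          (λ lower → refl , backward-loop fuel _ G l≡ e≡ budget′
            (B.passed I budget (λ eq → ⊥-elim (<⇒≢ (m∸n≡0⇒m≤n lower) eq))) fuel≤′))
        (λ spent → refl , result (stop refl) z≤n refl (B.aborted I budget spent)))
      (λ e≡0 → ⊥-elim (<-irrefl (sym e≡0) 0<e))

  ForwardInvariant : (σ : State) → Graph n m ins outs R (static σ) → (level₀ stamp₀ : ℕ → ℕ) → (S : ℕ) →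
    R (var σ V) (var σ W) → var σ HEIGHT ≤ S →
    var σ LATER ≡ 1 + var σ CLOCK → var σ EARLIER ≡ 2 + var σ CLOCK →
    List (ℕ × List ℕ) → ℕ → Set
  ForwardInvariant σ G level₀ stamp₀ S vw height≤ later≡ earlier≡ =
    Forward.Invariant acyclic {static σ} G level₀ stamp₀ S (var σ HEIGHT) vw height≤ later≡ earlier≡
      (var σ TOP) (var σ COUNT) (arr σ LEVEL) (arr σ CURSOR) (arr σ PARENT) (arr σ STAMP) (arr σ RANK)

  ForwardOutcome : (σ : State) → Graph n m ins outs R (static σ) → (level₀ stamp₀ : ℕ → ℕ) → (S : ℕ) →
    R (var σ V) (var σ W) → var σ HEIGHT ≤ S →
    var σ LATER ≡ 1 + var σ CLOCK → var σ EARLIER ≡ 2 + var σ CLOCK → ℕ → Set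
  ForwardOutcome σ G level₀ stamp₀ S vw height≤ later≡ earlier≡ bound =
    Forward.Outcome acyclic {static σ} G level₀ stamp₀ S (var σ HEIGHT) vw height≤ later≡ earlier≡
      bound (arr σ LEVEL) (arr σ STAMP) (arr σ RANK)

  record ForwardResult (σ : State) (level₀ stamp₀ : ℕ → ℕ) (S bound : ℕ) : Set where
    constructor result
    field
      {final}      : State
      {iterations} : ℕ
      {rest}       : ℕ
      run-loop     : Iterates TOP searchForward σ iterations final
      iterations≤  : iterations + rest ≤ bound
      frame        : forwardFrame final ≡ forwardFrame σ
      {graph}      : Graph n m ins outs R (static final)
      {arc}        : R (var final V) (var final W)
      {height≤}    : var final HEIGHT ≤ S
      {later≡}     : var final LATER ≡ 1 + var final CLOCK
      {earlier≡}   : var final EARLIER ≡ 2 + var final CLOCK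
      outcome      : ForwardOutcome final graph level₀ stamp₀ S arc height≤ later≡ earlier≡ rest

  -- The potential is itself the termination measure; what remains of it becomes `rest` and is
  -- handed on to later insertions.
  forward-loop : ∀ bound σ G level₀ stamp₀ S vw height≤ later≡ earlier≡ {stack} →
    ForwardInvariant σ G level₀ stamp₀ S vw height≤ later≡ earlier≡ stack bound →
    ForwardResult σ level₀ stamp₀ S bound
  forward-loop bound σ G level₀ stamp₀ S vw h≤ l≡ e≡ {[]} I =
    result (stop I.chain) ≤-refl refl (Forward.finished acyclic G level₀ stamp₀ S _ vw h≤ l≡ e≡ I)
    where module I = Forward.Invariant I
  forward-loop zero σ G level₀ stamp₀ S vw h≤ l≡ e≡ {_ ∷ _} I =
    ⊥-elim (<⇒≱ (s≤s z≤n) (m+n≤o⇒n≤o (deficit S outs n (arr σ LEVEL)) (Forward.Invariant.potential I)))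
  forward-loop (suc bound) σ G level₀ stamp₀ S vw h≤ l≡ e≡ {(x , rest) ∷ stack} I
    with Forward.Invariant.chain I
  ... | refl , 0<top , _ = one-more (step rest I)
    where
    module F = Forward acyclic G level₀ stamp₀ S (var σ HEIGHT) vw h≤ l≡ e≡
    After : State → Set
    After τ = forwardFrame τ ≡ forwardFrame σ × ForwardResult τ level₀ stamp₀ S bound
    one-more : After (exec searchForward σ) → ForwardResult σ level₀ stamp₀ S (suc bound)
    one-more (frame′ , result it i≤ frame outcome) =
      result (next 0<top it) (s≤s i≤) (trans frame frame′) outcome
    step : ∀ rest → ForwardInvariant σ G level₀ stamp₀ S vw h≤ l≡ e≡ ((var σ TOP , rest) ∷ stack) (suc bound) →
      After (exec searchForward σ)
    step [] I = select-elim After (arr σ CURSOR (var σ TOP))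
      (λ pos → ⊥-elim (<-irrefl (sym (F.Pending.chain (All.head (F.Invariant.frames I)))) pos))
      (λ _ → refl , forward-loop bound _ G level₀ stamp₀ S vw h≤ l≡ e≡ (F.placed-top I))
    step (e ∷ rest) I with F.Pending.chain (All.head (F.Invariant.frames I))
    ... | refl , 0<e , _ = select-elim After e
      (λ _ → select-elim After (var σ HEIGHT ∸ arr σ LEVEL (arr σ TARGET e))
        (λ lower → refl , forward-loop bound _ G level₀ stamp₀ S vw h≤ l≡ e≡
          (F.pushed I (m∸n≢0⇒n<m (>⇒≢ lower))))
        (λ higher → refl , forward-loop bound _ G level₀ stamp₀ S vw h≤ l≡ e≡
          (F.passed I (m∸n≡0⇒m≤n higher))))
      (λ e≡0 → ⊥-elim (<-irrefl (sym e≡0) 0<e))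

-- Counting distinct arcs

lookup-injective : ∀ {es : List ℕ} → Unique es → ∀ i j → lookup es i ≡ lookup es j → i ≡ j
lookup-injective (_ ∷ _)  Fin.zero    Fin.zero    _  = refl
lookup-injective (e∉ ∷ _) Fin.zero    (Fin.suc j) eq = ⊥-elim (All.lookup e∉ (∈-lookup j) eq)
lookup-injective (e∉ ∷ _) (Fin.suc i) Fin.zero    eq = ⊥-elim (All.lookup e∉ (∈-lookup i) (sym eq))
lookup-injective (_ ∷ u)  (Fin.suc i) (Fin.suc j) eq = cong Fin.suc (lookup-injective u i j eq)

-- Pigeonhole principle; `pred` appears because arcs are numbered from 1.
unique⇒length≤ : ∀ {m es} → Unique es → All (InRange m) es → length es ≤ m
unique⇒length≤ {m} {es} u range = injective⇒≤ {f = index} λ {i} {j} eq →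
  lookup-injective u i j (pred-injective {{>-nonZero (proj₁ (at i))}} {{>-nonZero (proj₁ (at j))}} (begin
    pred (lookup es i)  ≡⟨ toℕ-fromℕ< (below i) ⟨
    toℕ (index i)       ≡⟨ cong toℕ eq ⟩
    toℕ (index j)       ≡⟨ toℕ-fromℕ< (below j) ⟩
    pred (lookup es j)  ∎))
  where
  open ≡-Reasoning
  at : ∀ i → InRange m (lookup es i)
  at i = All.lookup range (∈-lookup i)
  pred< : ∀ {i} → 0 < i → i ≤ m → pred i < m
  pred< {suc i} _ le = le
  below : ∀ i → pred (lookup es i) < m
  below i = pred< (proj₁ (at i)) (proj₂ (at i))
  index : Fin (length es) → Fin m
  index i = fromℕ< (below i)

triangle : ℕ → ℕ
triangle zero    = 0
triangle (suc k) = suc k + triangle k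

square≤triangles : ∀ k → k * k ≤ 2 * triangle k
square≤triangles zero    = z≤n
square≤triangles (suc k) = begin
  suc k * suc k                    ≡⟨ *-suc (suc k) k ⟩
  suc k + (k + k * k)              ≤⟨ +-monoʳ-≤ (suc k) (+-mono-≤ (n≤1+n k) (square≤triangles k)) ⟩
  suc k + (suc k + 2 * triangle k) ≡⟨ +-assoc (suc k) (suc k) _ ⟨
  (suc k + suc k) + 2 * triangle k ≡⟨ cong (λ i → (suc k + i) + 2 * triangle k) (+-identityʳ (suc k)) ⟨
  2 * suc k + 2 * triangle k       ≡⟨ *-distribˡ-+ 2 (suc k) (triangle k) ⟨
  2 * (suc k + triangle k)         ∎
  where open ≤-Reasoning

-- The evidence that a cut-off search leaves behind. It speaks of reachability instead of the
-- search, so that descendants can inherit it.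
Support : (R : ℕ → ℕ → Set) (m : ℕ) (target level : ℕ → ℕ) → ℕ → ℕ → Set
Support R m target level z k = ∃[ es ] Unique es × length es ≡ suc k ×
  All (λ e → InRange m e × level (target e) ≡ k × Star R (target e) z) es

-- Bounding the levels

-- Level k + 1 is supported by k + 1 arcs into level k, and these arcs are
-- distinct for distinct levels.
module _ {R : ℕ → ℕ → Set} {m : ℕ} {target level : ℕ → ℕ}
  (support : ∀ z k → level z ≡ suc k → Support R m target level z k) where

  arcs-below : ∀ k z → level z ≡ k →
    ∃[ es ] Unique es × length es ≡ triangle k × All (λ e → InRange m e × level (target e) < k) es
  arcs-above : ∀ k z → Support R m target level z k →
    ∃[ es ] Unique es × length es ≡ triangle (suc k) × All (λ e → InRange m e × level (target e) < suc k) es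

  arcs-below zero    z eq = [] , [] , refl , []
  arcs-below (suc k) z eq = arcs-above k z (support z k eq)

  arcs-above k z (es@(e ∷ _) , u , length≡ , all@((_ , level≡ , _) ∷ _))
    with arcs-below k (target e) level≡
  ... | es′ , u′ , length≡′ , all′ = es ++ es′
    , Unique.++⁺ u u′ (λ (i , j) → <-irrefl (proj₁ (proj₂ (All.lookup all i))) (proj₂ (All.lookup all′ j)))
    , trans (length-++ es) (cong₂ _+_ length≡ length≡′)
    , All.++⁺ (All.map (λ (r , eq , _) → r , s≤s (≤-reflexive eq)) all)
        (All.map (λ (r , lt) → r , m≤n⇒m≤1+n lt) all′)

  -- Support is assumed instead of a vertex of level k + 1, because the new height has to be bounded
  -- before any vertex is raised to it.
  supported-level : ∀ {k z} → Support R m target level z k → suc k * suc k ≤ 2 * m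
  supported-level {k} {z} s with arcs-above k z s
  ... | es , u , length≡ , all = ≤-trans (square≤triangles (suc k))
    (*-monoʳ-≤ 2 (≤-trans (≤-reflexive (sym length≡)) (unique⇒length≤ u (All.map proj₁ all))))

  level-bound : ∀ z → level z * level z ≤ 2 * m
  level-bound z with level z in eq
  ... | zero  = z≤n
  ... | suc k = supported-level (support z k eq)

-- Reachability in the edge list, and linking an arc

Adj : ∀ {n} → List (Edge n) → ℕ → ℕ → Set
Adj H x y = ∃[ u ] ∃[ v ] (u , v) ∈ H × x ≡ suc (toℕ u) × y ≡ suc (toℕ v)

Adj-there : ∀ {n} {H : List (Edge n)} {e x y} → Adj H x y → Adj (e ∷ H) x y
Adj-there (u , v , i , eqs) = u , v , there i , eqs

Adj-acyclic : ∀ {n} {H : List (Edge n)} → Acyclic H → ∀ {x y} → Adj H x y → Star (Adj H) y x → ⊥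
Adj-acyclic {n} {H} acyclic (u , v , i , refl , refl) path =
  Sum.[ (λ { refl → acyclic u Plus.[ i ] }) , (λ p → acyclic v (p ∷ʳ i)) ] (walk path)
  where
  walk : ∀ {a b} → Star (Adj H) (suc (toℕ a)) (suc (toℕ b)) → a ≡ b ⊎ TransClosure (λ u v → (u , v) ∈ H) a b
  walk {a} {b} path = go path refl refl
    where
    -- The endpoints are generalised to numbers with equations so that the path can be matched.
    go : ∀ {x y a b} → Star (Adj H) x y → x ≡ suc (toℕ a) → y ≡ suc (toℕ b) →
      a ≡ b ⊎ TransClosure (λ u v → (u , v) ∈ H) a b
    go ε p q = inj₁ (toℕ-injective (suc-injective (trans (sym p) q)))
    go ((c , d , j , r , t) ◅ path) p q
      with toℕ-injective (suc-injective (trans (sym p) r)) | go path t q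
    ... | refl | inj₁ refl = inj₂ Plus.[ j ]
    ... | refl | inj₂ more = inj₂ (j Plus.∷ more)

InRange-suc : ∀ {m e} → InRange (suc m) e → InRange m e ⊎ e ≡ suc m
InRange-suc (0<e , e≤) with m≤n⇒m<n∨m≡n e≤
... | inj₁ (s≤s e≤m) = inj₁ (0<e , e≤m)
... | inj₂ eq        = inj₂ eq

out-of-range : ∀ {m e} → InRange m e → suc m ≢ e
out-of-range (_ , e≤m) refl = <⇒≱ ≤-refl e≤m

module _ {n m : ℕ} {ins outs : ℕ → List ℕ} {R R′ : ℕ → ℕ → Set} {s : Static} (G : Graph n m ins outs R s)
  (R⇒ : ∀ {x y} → R x y → R′ x y) where

  open Graph G
  open Static s

  -- `E` is a variable with an equation because the program computes it from `EDGES`, which equals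
  -- the number of edges only propositionally.
  graph-link : ∀ {a b c d f g x y} → R′ x y → InRange n x → InRange n y → ∀ E → E ≡ suc m →
    Graph n (suc m) (upd ins y (E ∷ ins y)) (upd outs x (E ∷ outs x)) R′
      (mkStatic a b c d f g (upd source E x) (upd target E y)
        (upd inHead y E) (upd inNext E (inHead y)) (upd outHead x E) (upd outNext E (outHead x)))
  graph-link {x = x} {y} xy x-range y-range E refl = record
    { arc = λ {e} r → endpoints (λ a b → R′ a b) xy (λ r′ → R⇒ (arc r′)) r
    ; source-range = endpoints (λ a _ → InRange n a) x-range source-range
    ; target-range = endpoints (λ _ b → InRange n b) y-range target-range
    ; ins-chain = lists ins inHead inNext y ins-chain (λ i → proj₁ (ins-sound i))
    ; outs-chain = lists outs outHead outNext x outs-chain (λ i → proj₁ (outs-sound i))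
    ; ins-sound = λ {e} {z} → upd-elim ins (λ es → e ∈ es → InRange (suc m) e × upd target E y e ≡ z) y z
        (λ { refl (here refl) → (z<s , ≤-refl) , upd-same target E
           ; refl (there i)   → old target (ins-sound i) })
        (λ _ i → old target (ins-sound i))
    ; outs-sound = λ {e} {z} → upd-elim outs (λ es → e ∈ es → InRange (suc m) e × upd source E x e ≡ z) x z
        (λ { refl (here refl) → (z<s , ≤-refl) , upd-same source E
           ; refl (there i)   → old source (outs-sound i) })
        (λ _ i → old source (outs-sound i))
    ; ins-complete = complete ins target y ins-complete
    ; outs-complete = complete outs source x outs-complete
    ; ins-unique = λ z → upd-elim ins Unique y z
        (λ _ → All.tabulate (λ i → out-of-range (proj₁ (ins-sound i))) ∷ ins-unique y)
        (λ _ → ins-unique z)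
    }
    where
    widen : ∀ {e} → InRange m e → InRange (suc m) e
    widen (p , q) = p , m≤n⇒m≤1+n q
    old : ∀ end {new e z} → InRange m e × end e ≡ z → InRange (suc m) e × upd end E new e ≡ z
    old end (r , eq) = widen r , trans (upd-other end (out-of-range r)) eq
    endpoints : (P : ℕ → ℕ → Set) → P x y → (∀ {e} → InRange m e → P (source e) (target e)) →
      ∀ {e} → InRange (suc m) e → P (upd source E x e) (upd target E y e)
    endpoints P new old {e} r with InRange-suc r
    ... | inj₁ r′ rewrite upd-other source {x} (out-of-range r′) | upd-other target {y} (out-of-range r′) = old r′
    ... | inj₂ refl rewrite upd-same source E {x} | upd-same target E {y} = new
    lists : ∀ es head nx a → (∀ z → Chain nx (head z) (es z)) → (∀ {e z} → e ∈ es z → InRange m e) →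
      ∀ z → Chain (upd nx E (head a)) (upd head a E z) (upd es a (E ∷ es a) z)
    lists es head nx a chains range z with a ≟ z
    ... | yes refl rewrite upd-same head a {E} | upd-same es a {E ∷ es a} | upd-same nx E {head a} =
      refl , z<s , chain-cong (es a) (λ i → sym (upd-other nx (out-of-range (range i)))) (chains a)
    ... | no a≢z rewrite upd-other head {E} a≢z | upd-other es {E ∷ es a} a≢z =
      chain-cong (es z) (λ i → sym (upd-other nx (out-of-range (range i)))) (chains z)
    complete : ∀ es end a → (∀ {e} → InRange m e → e ∈ es (end e)) →
      ∀ {e} → InRange (suc m) e → e ∈ upd es a (E ∷ es a) (upd end E a e)
    complete es end a comp {e} r with InRange-suc r
    ... | inj₂ refl rewrite upd-same end E {a} | upd-same es a {E ∷ es a} = here refl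
    ... | inj₁ r′ rewrite upd-other end {a} (out-of-range r′) =
      upd-elim es (e ∈_) a (end e) (λ { refl → there (comp r′) }) (λ _ → comp r′)

-- Raising to `height` everything of lower level that is reachable from w does
-- not destroy support: a vertex below which something was raised is reachable
-- from w, and inherits the support of v.
module _ {R : ℕ → ℕ → Set} {m height v w : ℕ} {target level₀ level : ℕ → ℕ}
  (acyclic : ∀ {x y} → R x y → Star R y x → ⊥) (vw : R v w)
  (mono : ∀ {x y} → R x y → level x ≤ level y)
  (levels : ∀ x → level x ≡ level₀ x ⊎ (level₀ x < height × level x ≡ height × Star R w x))
  (raised : height ≤ level w)
  (support₀ : ∀ z k → level₀ z ≡ suc k → Support R m target level₀ z k)
  (supportV : ∀ k → height ≡ suc k → Support R m target level₀ v k)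
  where

  private
    mono* : ∀ {x y} → Star R x y → level x ≤ level y
    mono* ε          = ≤-refl
    mono* (xy ◅ path) = ≤-trans (mono xy) (mono* path)

    via-w : ∀ {z k} → height ≡ suc k → Star R w z → Support R m target level z k
    via-w {z} {k} height≡ wz with supportV k height≡
    ... | es , u , length≡ , all = es , u , length≡ , All.map keep all
      where
      keep : ∀ {e} → InRange m e × level₀ (target e) ≡ k × Star R (target e) v →
        InRange m e × level (target e) ≡ k × Star R (target e) z
      keep {e} (r , eq , path) with levels (target e)
      ... | inj₁ same = r , trans same eq , path ◅◅ vw ◅ wz
      -- Nothing that reaches v was raised: being reachable from w, it would close a cycle.
      ... | inj₂ (_ , _ , wt) = ⊥-elim (acyclic vw (wt ◅◅ path))

  support-raise : ∀ z k → level z ≡ suc k → Support R m target level z k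
  support-raise z k level≡ with levels z
  ... | inj₂ (_ , eq , wz) = via-w (trans (sym eq) level≡) wz
  ... | inj₁ same with support₀ z k (trans (sym same) level≡)
  ...   | es , u , length≡ , all with All.all? (λ e → level (target e) ≟ k) es
  ...     | yes keep = es , u , length≡ , All.zipWith (λ ((r , _ , p) , eq) → r , eq , p) (all , keep)
  ...     | no changed with find (All.¬All⇒Any¬ (λ e → level (target e) ≟ k) es changed)
  ...       | e , i , ne with All.lookup all i | levels (target e)
  ...         | _ , eq , _ | inj₁ same′ = ⊥-elim (ne (trans same′ eq))
  -- The target was raised from level k, so k < `height`; it lies on a path from w to z, so `height`
  -- is at most the level of z, which is k + 1. Hence `height` is k + 1, and z inherits the support
  -- of v.
  ...         | _ , eq , path | inj₂ (lt , _ , wt) =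
                  via-w (≤-antisym
                    (≤-trans raised (≤-trans (mono* (wt ◅◅ path)) (≤-reflexive level≡)))
                    (subst (_< height) eq lt)) (wt ◅◅ path)

-- The invariant between requests, and one insertion

Present : ∀ {n} → List (Edge n) → (source target : ℕ → ℕ) → Set
Present H source target = ∀ {u t} → (u , t) ∈ H →
  ∃[ e ] InRange (length H) e × source e ≡ suc (toℕ u) × target e ≡ suc (toℕ t)

record Maintained {n} (H : List (Edge n)) (S D : ℕ) (σ : State) : Set where
  field
    {ins outs} : ℕ → List ℕ
    edges≡     : var σ EDGES ≡ length H
    graph      : Graph n (length H) ins outs (Adj H) (static σ)
    present    : Present H (arr σ SOURCE) (arr σ TARGET)
    sorted     : ∀ {e} → InRange (length H) e →
      Before (arr σ LEVEL) (arr σ STAMP) (arr σ RANK) (arr σ SOURCE e) (arr σ TARGET e)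
    stamp≤     : ∀ x → arr σ STAMP x ≤ var σ CLOCK
    mark≤      : ∀ x → arr σ MARK x ≤ var σ CLOCK
    support    : ∀ z k → arr σ LEVEL z ≡ suc k → Support (Adj H) (length H) (arr σ TARGET) (arr σ LEVEL) z k
    potential  : deficit S outs n (arr σ LEVEL) ≤ D

record Inserted {n} (H : List (Edge n)) (S D : ℕ) (σ : State) : Set where
  field
    {afterSearch afterRaise}       : State
    {backwardSteps forwardSteps D′} : ℕ
    search    : Iterates TOP searchBackward (exec beginInsert σ) backwardSteps afterSearch
    raise     : Iterates TOP searchForward (exec beginRaise afterSearch) forwardSteps afterRaise
    -- The initial `FUEL` is 1 + 2 (k + 1), and k is at most `S`.
    search≤   : backwardSteps ≤ 3 + (S + S)
    -- The `S` on the right pays for the new arc, which v may have to scan once for each level it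
    -- can still rise.
    raise≤    : forwardSteps + D′ ≤ D + S
    maintains : Maintained H S D′ (exec link afterRaise)

vertex-range : ∀ {n} {i} (x : Fin n) → i ≡ suc (toℕ x) → InRange n i
vertex-range x refl = z<s , toℕ<n x

module Insertion {n : ℕ} {H : List (Edge n)} {x y : Fin n} {S : ℕ}
  (acyclicH : Acyclic ((x , y) ∷ H)) (height-bound : ∀ k → k * k ≤ 2 * length H → k ≤ S) where

  private
    m = length H
    R = Adj ((x , y) ∷ H)

    acyclic : ∀ {a b} → R a b → Star R b a → ⊥
    acyclic = Adj-acyclic acyclicH

  record Stage (ins outs : ℕ → List ℕ) (s : Static) : Set where
    open Static s
    field
      edges≡   : edges ≡ m
      graph    : Graph n m ins outs R s
      present  : Present H source target
      later≡   : later ≡ 1 + clock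
      earlier≡ : earlier ≡ 2 + clock
      v≡       : v ≡ suc (toℕ x)
      w≡       : w ≡ suc (toℕ y)
    vw : R v w
    vw = x , y , here refl , v≡ , w≡

  -- A predicate on the frame instead of the state: equality of frames carries all of it across the
  -- loop in a single `subst`.
  SearchStage : (ins outs : ℕ → List ℕ) (D : ℕ) → Static × ℕ × (ℕ → ℕ) → Set
  SearchStage ins outs D (s , height , level) =
    Stage ins outs s × height ≡ level v × deficit S outs n level ≤ D ×
    (∀ z k → level z ≡ suc k → Support R m target level z k)
    where open Static s

  RaiseStage : (ins outs : ℕ → List ℕ) (level₀ stamp₀ : ℕ → ℕ) → Static × ℕ × (ℕ → ℕ) → Set
  RaiseStage ins outs level₀ stamp₀ (s , height , mark) =
    Stage ins outs s × (∀ a → mark a ≤ later) ×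
    (height ≡ level₀ v × stamp₀ v ≡ earlier ⊎ height ≡ suc (level₀ v)) ×
    (∀ k → height ≡ suc k → Support R m target level₀ v k) ×
    (∀ z k → level₀ z ≡ suc k → Support R m target level₀ z k)
    where open Static s

  module _ {σ : State} {D : ℕ} (X≡ : var σ X ≡ toℕ x) (Y≡ : var σ Y ≡ toℕ y) (I : Maintained H S D σ) where

    open Maintained I

    private
      σ₁ = exec beginInsert σ

      graph₁ : Graph n m ins outs R (static σ₁)
      graph₁ = record { Graph graph hiding (arc) ; arc = λ r → Adj-there (Graph.arc graph r) }

    search-stage : SearchStage ins outs D (backwardFrame σ₁)
    search-stage = record
      { edges≡ = edges≡ ; graph = graph₁ ; present = present ; later≡ = refl ; earlier≡ = refl
      ; v≡ = cong suc X≡ ; w≡ = cong suc Y≡ }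
      , refl , potential
      , λ z k eq → let es , u , l≡ , all = support z k eq in
          es , u , l≡ , All.map (λ (a , b , p) → a , b , gmap (λ i → i) Adj-there p) all

    search-result : BackwardResult {n} {m} {ins} {outs} acyclic σ₁ (var σ₁ FUEL)
    search-result = backward-loop acyclic (var σ₁ FUEL) σ₁ graph₁ refl refl z<s
      (Backward.initial acyclic graph₁ (arr σ LEVEL) _ refl refl z<s refl mark≤ stamp≤ sorted) ≤-refl

  module _ {ins outs : ℕ → List ℕ} {D : ℕ} (σ : State) {G l≡ e≡} (stage : SearchStage ins outs D (backwardFrame σ))
    (outcome : BackwardOutcome {n} {m} {ins} {outs} acyclic σ G l≡ e≡) where

    open Stage (proj₁ stage)
    open Backward.Outcome outcome

    private
      height : ℕ
      height = 1 ∸ var σ BUDGET + var σ HEIGHT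

      support₀ : ∀ z k → arr σ LEVEL z ≡ suc k → Support R m (arr σ TARGET) (arr σ LEVEL) z k
      support₀ = proj₂ (proj₂ (proj₂ stage))

      -- After a complete search the height is the level of v, whose own support is reused. After a
      -- cut-off the scanned arcs are the support.
      supported : (height ≡ arr σ LEVEL (var σ V) × arr σ STAMP (var σ V) ≡ var σ EARLIER ⊎
                   height ≡ suc (arr σ LEVEL (var σ V))) ×
        (∀ k → height ≡ suc k → Support R m (arr σ TARGET) (arr σ LEVEL) (var σ V) k)
      supported with verdict
      ... | inj₁ (0<b , placed) = inj₁ (height≡ , placed) , λ k eq → support₀ _ k (trans (sym height≡) eq)
        where
        height≡ : height ≡ arr σ LEVEL (var σ V)
        height≡ = trans (cong (_+ var σ HEIGHT) (m≤n⇒m∸n≡0 0<b)) (proj₁ (proj₂ stage))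
      ... | inj₂ (b≡0 , es , u , l≡ , all) = inj₂ (trans height≡ (cong suc (proj₁ (proj₂ stage))))
        , λ k eq → subst (Support R m (arr σ TARGET) (arr σ LEVEL) (var σ V))
            (suc-injective (trans (sym height≡) eq)) (es , u , l≡ , all)
        where
        height≡ : height ≡ suc (var σ HEIGHT)
        height≡ = cong (λ b → 1 ∸ b + var σ HEIGHT) b≡0

      height≤S : height ≤ S
      height≤S with height in eq
      ... | zero  = z≤n
      ... | suc k = height-bound (suc k) (supported-level support₀ (proj₂ supported k eq))

    raise-result : forwardFrame (exec beginRaise σ) ≡ (static σ , height , arr σ MARK) ×
      ForwardResult {n} {m} {ins} {outs} acyclic (exec beginRaise σ) (arr σ LEVEL) (arr σ STAMP) S D
    raise-result = select-elim
      (λ τ → forwardFrame τ ≡ (static σ , height , arr σ MARK) ×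
        ForwardResult {n} {m} {ins} {outs} acyclic τ (arr σ LEVEL) (arr σ STAMP) S D)
      (height ∸ arr σ LEVEL (var σ W))
      (λ pos → refl , forward-loop acyclic D _ graph (arr σ LEVEL) (arr σ STAMP) S vw height≤S later≡ earlier≡
        (weaken (Forward.initial acyclic graph (arr σ LEVEL) (arr σ STAMP) S height vw height≤S later≡ earlier≡
          sorted placed (vertex-range y w≡) (m∸n≢0⇒n<m (>⇒≢ pos)))))
      (λ zer → refl , forward-loop acyclic D _ graph (arr σ LEVEL) (arr σ STAMP) S vw height≤S later≡ earlier≡
        (weaken (Forward.initial-idle acyclic graph (arr σ LEVEL) (arr σ STAMP) S height vw height≤S later≡ earlier≡
          sorted placed stopped (m∸n≡0⇒m≤n zer))))
      where
      weaken : ∀ {top count level cursor parent stamp rank stack} →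
        Forward.Invariant acyclic graph (arr σ LEVEL) (arr σ STAMP) S height vw height≤S later≡ earlier≡
          top count level cursor parent stamp rank stack (deficit S outs n (arr σ LEVEL)) →
        Forward.Invariant acyclic graph (arr σ LEVEL) (arr σ STAMP) S height vw height≤S later≡ earlier≡
          top count level cursor parent stamp rank stack D
      weaken J = record { Forward.Invariant J hiding (potential)
                        ; potential = ≤-trans (Forward.Invariant.potential J) (proj₁ (proj₂ (proj₂ stage))) }

    raise-stage : RaiseStage ins outs (arr σ LEVEL) (arr σ STAMP) (static σ , height , arr σ MARK)
    raise-stage = proj₁ stage , mark≤ , proj₁ supported , proj₂ supported , support₀

  module _ {ins outs : ℕ → List ℕ} {level₀ stamp₀ : ℕ → ℕ} (σ : State) {G arc h≤ l≡ e≡ D}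
    (stage : RaiseStage ins outs level₀ stamp₀ (forwardFrame σ))
    (outcome : ForwardOutcome {n} {m} {ins} {outs} acyclic σ G level₀ stamp₀ S arc h≤ l≡ e≡ D) where

    open Stage (proj₁ stage)
    open Forward.Outcome outcome

    private
      level = arr σ LEVEL
      stamp = arr σ STAMP
      rank  = arr σ RANK
      v = var σ V
      w = var σ W
      height = var σ HEIGHT
      clock = var σ CLOCK
      earlier = var σ EARLIER
      source = arr σ SOURCE
      target = arr σ TARGET
      E = suc (var σ EDGES)

      E≡ : E ≡ suc m
      E≡ = cong suc edges≡

      later<earlier : var σ LATER < earlier
      later<earlier = subst₂ _<_ (sym later≡) (sym earlier≡) ≤-refl

      clock<later : clock < var σ LATER
      clock<later = ≤-reflexive (sym later≡)

      v-unreached : ¬ Star R w v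
      v-unreached = acyclic vw

      level-v : level v ≡ level₀ v
      level-v with levels v
      ... | inj₁ eq           = eq
      ... | inj₂ (_ , _ , wv) = ⊥-elim (v-unreached wv)

      stamp-w : stamp w < earlier
      stamp-w with placed w
      ... | inj₁ old            = <-trans (≤-<-trans old clock<later) later<earlier
      ... | inj₂ (inj₁ eq)      = subst (_< earlier) (sym eq) later<earlier
      ... | inj₂ (inj₂ (_ , wv)) = ⊥-elim (v-unreached wv)

      -- A cut-off puts w on a higher level. Otherwise v and w may share a level, and then v is
      -- stamped `earlier`, which w cannot be, as it does not reach v.
      v-before-w : Before level stamp rank v w
      v-before-w with proj₁ (proj₂ (proj₂ stage))
      ... | inj₂ eq = inj₁ (subst (_≤ level w) (trans eq (cong suc (sym level-v))) raised)
      ... | inj₁ (eq , placed-v) with m≤n⇒m<n∨m≡n (subst (_≤ level w) (trans eq (sym level-v)) raised)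
      ...   | inj₁ lt  = inj₁ lt
      ...   | inj₂ eq′ = inj₂ (eq′ , inj₁ (subst (stamp w <_) (sym (trans (origin v v-unreached) placed-v)) stamp-w))

      mono : ∀ {a b} → R a b → level a ≤ level b
      mono (_ , _ , here refl , refl , refl) = subst₂ (λ a b → level a ≤ level b) v≡ w≡
        (before⇒level≤ {level} {stamp} {rank} v-before-w)
      mono (_ , _ , there i , refl , refl) with present i
      ... | e , r , eq , eq′ = subst₂ (λ a b → level a ≤ level b) eq eq′
        (before⇒level≤ {level} {stamp} {rank} (sorted r))

      support : ∀ z k → level z ≡ suc k → Support R m target level z k
      support = support-raise acyclic vw mono levels raised
        (proj₂ (proj₂ (proj₂ (proj₂ stage)))) (proj₁ (proj₂ (proj₂ (proj₂ stage))))

    linked : Maintained ((x , y) ∷ H) S (D + S) (exec link σ)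
    linked = record
      { edges≡ = E≡
      ; graph = graph-link graph (λ r → r) vw (vertex-range x v≡) (vertex-range y w≡) E E≡
      ; present = present′ E E≡
      ; sorted = sorted′ E E≡
      ; stamp≤ = stamp≤
      ; mark≤ = λ a → ≤-trans (proj₁ (proj₂ stage) a) (<⇒≤ later<earlier)
      ; support = support′ E E≡
      ; potential = potential′
      }
      where
      present′ : ∀ E → E ≡ suc m → Present ((x , y) ∷ H) (upd source E v) (upd target E w)
      present′ E refl (here refl) = E , (z<s , ≤-refl) , trans (upd-same source E) v≡ , trans (upd-same target E) w≡
      present′ E refl (there i) with present i
      ... | e , r@(0<e , e≤) , eq , eq′ = e , (0<e , m≤n⇒m≤1+n e≤)
        , trans (upd-other source (out-of-range r)) eq , trans (upd-other target (out-of-range r)) eq′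
      sorted′ : ∀ E → E ≡ suc m → ∀ {e} → InRange (suc m) e →
        Before level stamp rank (upd source E v e) (upd target E w e)
      sorted′ E refl {e} r with InRange-suc r
      ... | inj₂ refl rewrite upd-same source E {v} | upd-same target E {w} = v-before-w
      ... | inj₁ r′ rewrite upd-other source {v} (out-of-range r′) | upd-other target {w} (out-of-range r′) = sorted r′
      support′ : ∀ E → E ≡ suc m → ∀ z k → level z ≡ suc k → Support R (suc m) (upd target E w) level z k
      support′ E refl z k eq with support z k eq
      ... | es , u , l≡ , all = es , u , l≡ , All.map keep all
        where
        keep : ∀ {e} → InRange m e × level (target e) ≡ k × Star R (target e) z →
          InRange (suc m) e × level (upd target E w e) ≡ k × Star R (upd target E w e) z
        keep (r@(0<e , e≤) , p) rewrite upd-other target {w} (out-of-range r) = (0<e , m≤n⇒m≤1+n e≤) , p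
      stamp≤ : ∀ a → stamp a ≤ earlier
      stamp≤ a with placed a
      ... | inj₁ old            = ≤-trans old (<⇒≤ (<-trans clock<later later<earlier))
      ... | inj₂ (inj₁ eq)      = ≤-trans (≤-reflexive eq) (<⇒≤ later<earlier)
      ... | inj₂ (inj₂ (eq , _)) = ≤-reflexive eq
      potential′ : deficit S (upd outs v (E ∷ outs v)) n level ≤ D + S
      potential′ = ≤-trans (sumTo-grow n
        (λ a v≢a → ≤-reflexive (cong (λ es → (S ∸ level a) * suc (length es)) (upd-other outs v≢a)))
        (≤-trans (≤-reflexive (cong (λ es → (S ∸ level v) * suc (length es)) (upd-same outs v)))
        (≤-trans (≤-reflexive (trans (*-suc (S ∸ level v) _) (+-comm (S ∸ level v) _)))
          (+-monoʳ-≤ _ (m∸n≤m S (level v))))))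
        (+-monoˡ-≤ S potential)

  insertion : ∀ {σ D} → var σ X ≡ toℕ x → var σ Y ≡ toℕ y → Maintained H S D σ → Inserted ((x , y) ∷ H) S D σ
  insertion {σ} {D} X≡ Y≡ I = after-search (search-result X≡ Y≡ I)
    where
    open Maintained I
    k = arr σ LEVEL (suc (var σ X))
    k≤S : k ≤ S
    k≤S = height-bound k (level-bound support (suc (var σ X)))
    fuel≤ : suc k + suc k ≤ 2 + (S + S)
    fuel≤ = s≤s (≤-trans (≤-reflexive (+-suc k k)) (s≤s (+-mono-≤ k≤S k≤S)))
    after-search : BackwardResult {n} {m} {ins} {outs} acyclic (exec beginInsert σ) (var (exec beginInsert σ) FUEL) →
      Inserted ((x , y) ∷ H) S D σ
    after-search (result {σ₂} {i} search search≤ frame outcome) = after-raise (raise-result σ₂ stage outcome)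
      where
      stage : SearchStage ins outs D (backwardFrame σ₂)
      stage = subst (SearchStage ins outs D) (sym frame) (search-stage X≡ Y≡ I)
      after-raise : forwardFrame (exec beginRaise σ₂) ≡ (static σ₂ , 1 ∸ var σ₂ BUDGET + var σ₂ HEIGHT , arr σ₂ MARK) ×
        ForwardResult {n} {m} {ins} {outs} acyclic (exec beginRaise σ₂) (arr σ₂ LEVEL) (arr σ₂ STAMP) S D →
        Inserted ((x , y) ∷ H) S D σ
      after-raise (frame₁ , result {σ₄} {j} {rest} raise raise≤ frame₂ outcome₂) = record
        { search = search ; raise = raise
        ; search≤ = ≤-trans search≤ (s≤s fuel≤)
        ; raise≤ = ≤-trans (≤-reflexive (sym (+-assoc j rest S))) (+-monoˡ-≤ S raise≤)
        ; maintains = linked σ₄ stage₄ outcome₂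
        }
        where
        stage₄ : RaiseStage ins outs (arr σ₂ LEVEL) (arr σ₂ STAMP) (forwardFrame σ₄)
        stage₄ = subst (RaiseStage ins outs (arr σ₂ LEVEL) (arr σ₂ STAMP))
          (sym (trans frame₂ frame₁)) (raise-stage σ₂ stage outcome)

-- Integer square root and the estimate of the total time

isqrt : ∀ k → Σ[ S ∈ ℕ ] S * S ≤ k × k < suc S * suc S
isqrt zero    = 0 , z≤n , z<s
isqrt (suc k) with isqrt k
... | S , S²≤k , k< with suc k <? suc S * suc S
...   | yes lt = S , m≤n⇒m≤1+n S²≤k , lt
...   | no ≮   = suc S , ≮⇒≥ ≮ , ≤-<-trans k< (*-mono-< {suc S} {2 + S} ≤-refl ≤-refl)

≤isqrt : ∀ {k S j} → k < suc S * suc S → j * j ≤ k → j ≤ S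
≤isqrt {k} {S} {j} k< j²≤k = ≮⇒≥ λ S<j → <⇒≱ k< (≤-trans (*-mono-≤ S<j S<j) j²≤k)

sumTo-const : ∀ n c → sumTo n (λ _ → c) ≡ n * c
sumTo-const zero    c = refl
sumTo-const (suc n) c = cong (c +_) (sumTo-const n c)

n≤n² : ∀ n → n ≤ n * n
n≤n² zero    = z≤n
n≤n² (suc n) = m≤m*n (suc n) (suc n)

-- (1 + S)² ≤ 9 m because S² ≤ 2 m and m ≥ 1.
time-bound : ∀ c k {n m S} l d → 1 ≤ n → n ≤ k * m → S * S ≤ 2 * m →
  1 + c * (n * S + m * (4 + (S + (S + S)))) ≤ (3 * (1 + c * (k + 4)) + d) * (m + l) √ m
time-bound c k {n} {zero} l d 1≤n n≤ _ = ⊥-elim (<⇒≱ 1≤n (subst (n ≤_) (*-zeroʳ k) n≤))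
time-bound c k {n} {m@(suc _)} {S} l d 1≤n n≤ S²≤ = begin
  B * B                               ≤⟨ *-mono-≤ B≤ B≤ ⟩
  (P * Q) * (P * Q)                   ≡⟨ square P m (suc S) ⟩
  (P * m) * (P * m) * (suc S * suc S) ≤⟨ *-monoʳ-≤ ((P * m) * (P * m)) root ⟩
  (P * m) * (P * m) * (9 * m)         ≡⟨ absorb P m ⟩
  (3 * P * m) * (3 * P * m) * m       ≤⟨ *-monoˡ-≤ m (*-mono-≤ larger larger) ⟩
  ((3 * P + d) * (m + l)) * ((3 * P + d) * (m + l)) * m ∎
  where
  open ≤-Reasoning
  B = 1 + c * (n * S + m * (4 + (S + (S + S))))
  -- The 1 absorbs the initialisation, `k` the term n S through n ≤ k m, and 4 the cost 4 + 3 S of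
  -- each edge.
  P = 1 + c * (k + 4)
  Q = m * suc S
  square : ∀ P m s → (P * (m * s)) * (P * (m * s)) ≡ (P * m) * (P * m) * (s * s)
  square = solve-∀
  absorb : ∀ P m → (P * m) * (P * m) * (9 * m) ≡ (3 * P * m) * (3 * P * m) * m
  absorb = solve-∀
  expand : ∀ S → suc S * suc S ≡ 1 + (S + S + S * S)
  expand = solve-∀
  triple : ∀ m → 2 * m + 2 * m + 2 * m ≡ 6 * m
  triple = solve-∀
  collect : ∀ c k m S → m * suc S + c * (k * (m * suc S) + 4 * (m * suc S)) ≡ (1 + c * (k + 4)) * (m * suc S)
  collect = solve-∀
  B≤ : B ≤ P * Q
  B≤ = begin
    1 + c * (n * S + m * (4 + (S + (S + S))))
      ≤⟨ +-mono-≤ (s≤s z≤n) (*-monoʳ-≤ c (+-mono-≤ vertex-part edge-part)) ⟩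
    Q + c * (k * Q + 4 * Q)
      ≡⟨ collect c k m S ⟩
    P * Q ∎
    where
    vertex-part : n * S ≤ k * Q
    vertex-part = ≤-trans (*-mono-≤ n≤ (n≤1+n S)) (≤-reflexive (*-assoc k m (suc S)))
    shape : ∀ m S → m * (4 + (S + (S + S))) + m * S ≡ 4 * (m * suc S)
    shape = solve-∀
    edge-part : m * (4 + (S + (S + S))) ≤ 4 * Q
    edge-part = ≤-trans (m≤m+n _ (m * S)) (≤-reflexive (shape m S))
  S≤S² : S ≤ S * S
  S≤S² = n≤n² S
  root : suc S * suc S ≤ 9 * m
  root = begin
    suc S * suc S                  ≡⟨ expand S ⟩
    1 + (S + S + S * S)            ≤⟨ +-mono-≤ {1} {3 * m} (s≤s z≤n)
                                        (+-mono-≤ (+-mono-≤ (≤-trans S≤S² S²≤) (≤-trans S≤S² S²≤)) S²≤) ⟩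
    3 * m + (2 * m + 2 * m + 2 * m) ≡⟨ cong (3 * m +_) (triple m) ⟩
    3 * m + 6 * m                  ≡⟨ *-distribʳ-+ m 3 6 ⟨
    9 * m                          ∎
  larger : 3 * P * m ≤ (3 * P + d) * (m + l)
  larger = *-mono-≤ (m≤m+n (3 * P) d) (m≤m+n m l)


-- Amortised accounting over a list of requests

module Analysis (A : OnlineAlgorithm) (O : StrictTotalOrder 0ℓ 0ℓ 0ℓ)
  (ord : ∀ n → Memory → Fin n → StrictTotalOrder.Carrier O) (c d : ℕ)
  -- The machine enters only through this predicate and the facts below, so the accounting never
  -- unfolds a compiled program.
  (Good : ∀ {n} → ℕ → List (Edge n) → ℕ → Memory → Set)
  (good-initially : ∀ n S →
    ∃[ M ] ⟨ OnlineAlgorithm.initialise A , blank [ 0 ≔ n ] ⟩⇓⟨ 1 , M ⟩ × Good {n} S [] (n * S) M)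
  (good⇒topological : ∀ {n S} {H : List (Edge n)} {D M} → Good {n} S H D M → TopologicalOrdering A O (ord n) H M)
  (insert-good : ∀ {n S} {H : List (Edge n)} {D M} (e : Edge n) → Acyclic (e ∷ H) →
    (∀ k → k * k ≤ 2 * length H → k ≤ S) →
    Good S H D M → ∃[ t ] ∃[ M′ ] ∃[ D′ ] ⟨ OnlineAlgorithm.onInsert A , call M e ⟩⇓⟨ t , M′ ⟩ ×
      t + c * D′ ≤ c * (D + (4 + (S + (S + S)))) × Good S (e ∷ H) D′ M′)
  (compare-good : ∀ {n S} {H : List (Edge n)} {D M} (x y : Fin n) → Good S H D M →
    ∃[ t ] ∃[ M′ ] ⟨ OnlineAlgorithm.onCompare A , call M (x , y) ⟩⇓⟨ t , M′ ⟩ × t ≤ d ×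
      (0 < M′ 0) ⇔ StrictTotalOrder._<_ O (ord n M x) (ord n M y) ×
      (∀ v → StrictTotalOrder._≈_ O (ord n M′ v) (ord n M v)) × Good S H D M′)
  where

  module _ {n : ℕ} (all : List (Edge n)) (acyclic : Acyclic all) (S : ℕ)
    (height-bound : ∀ k → k * k ≤ 2 * length all → k ≤ S) where

    private
      perInsertion = 4 + (S + (S + S))

    acyclic-⊆ : ∀ {H} → (∀ {e} → e ∈ H → e ∈ all) → Acyclic H
    acyclic-⊆ {H} H⊆ x cycle = acyclic x (embed cycle)
      where
      embed : ∀ {a b} → TransClosure (λ u v → (u , v) ∈ H) a b → TransClosure (λ u v → (u , v) ∈ all) a b
      embed Plus.[ i ]   = Plus.[ H⊆ i ]
      embed (i Plus.∷ p) = H⊆ i Plus.∷ embed p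

    Served : List (Edge n) → ℕ → Memory → List (Request n) → Set
    Served H D M rs = Σ[ s ∈ Serves A O (ord n) H M rs ]
      insertTime A O (ord n) s ≤ c * (D + length (insertions rs) * perInsertion) ×
      compareTime A O (ord n) s ≤ d * #comparisons rs

    serve : ∀ rs {H M D} → length H + length (insertions rs) ≤ length all →
      (∀ {e} → e ∈ H → e ∈ all) → (∀ {e} → e ∈ insertions rs → e ∈ all) →
      Good S H D M → Served H D M rs
    serve [] _ _ _ _ = done , z≤n , z≤n
    serve (insert e ∷ rs) {H} {M} {D} len H⊆ rs⊆ good
      with insert-good e (acyclic-⊆ H′⊆)
             -- `S` is fixed by the final number of edges, which dominates the number inserted so
             -- far.
             (λ k le → height-bound k (≤-trans le (*-monoʳ-≤ 2 (m+n≤o⇒m≤o (length H) len)))) good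
      where
      H′⊆ : ∀ {e′} → e′ ∈ e ∷ H → e′ ∈ all
      H′⊆ (here refl) = rs⊆ (here refl)
      H′⊆ (there i)   = H⊆ i
    ... | t , M′ , D′ , exe , t≤ , good′
      with serve rs {e ∷ H} (≤-trans (≤-reflexive (sym (+-suc (length H) _))) len)
             (λ { (here refl) → rs⊆ (here refl) ; (there i) → H⊆ i }) (λ i → rs⊆ (there i)) good′
    ... | s , insertTime≤ , compareTime≤ =
      insert exe (good⇒topological good′) s , total , compareTime≤
      where
      open ≤-Reasoning
      L = length (insertions rs) * perInsertion
      total : t + insertTime A O (ord n) s ≤ c * (D + (perInsertion + L))
      total = begin
        t + insertTime A O (ord n) s  ≤⟨ +-monoʳ-≤ t insertTime≤ ⟩
        t + c * (D′ + L)              ≡⟨ cong (t +_) (*-distribˡ-+ c D′ L) ⟩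
        t + (c * D′ + c * L)          ≡⟨ +-assoc t (c * D′) (c * L) ⟨
        t + c * D′ + c * L            ≤⟨ +-monoˡ-≤ (c * L) t≤ ⟩
        c * (D + perInsertion) + c * L ≡⟨ *-distribˡ-+ c (D + perInsertion) L ⟨
        c * (D + perInsertion + L)    ≡⟨ cong (c *_) (+-assoc D perInsertion L) ⟩
        c * (D + (perInsertion + L))  ∎
    serve (compare x y ∷ rs) len H⊆ rs⊆ good with compare-good x y good
    ... | t , M′ , exe , t≤ , answer , unchanged , good′ with serve rs len H⊆ rs⊆ good′
    ... | s , insertTime≤ , compareTime≤ = compare exe answer unchanged s , insertTime≤
      , ≤-trans (+-mono-≤ t≤ compareTime≤) (≤-reflexive (sym (*-suc d _)))

  execution : ∀ n (rs : List (Request n)) → Admissible rs →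
    let m = length (insertions rs) ; S = proj₁ (isqrt (2 * m)) in
    Σ[ E ∈ Execution A O (ord n) rs ]
      Execution.maintenanceTime E ≤ 1 + c * (n * S + m * (4 + (S + (S + S)))) ×
      Execution.totalTime E ≤ Execution.maintenanceTime E + d * #comparisons rs
  execution n rs (_ , acyclic) = record { initialised = proj₁ (proj₂ initially) ; served = proj₁ served }
    , s≤s (proj₁ (proj₂ served))
    , +-monoʳ-≤ (suc (insertTime A O (ord n) (proj₁ served))) (proj₂ (proj₂ served))
    where
    m = length (insertions rs)
    S = proj₁ (isqrt (2 * m))
    initially = good-initially n S
    served = serve (insertions rs) acyclic S (λ k → ≤isqrt {j = k} (proj₂ (proj₂ (isqrt (2 * m)))))
      rs ≤-refl (λ ()) (λ i → i) (proj₂ (proj₂ initially))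

  time-analysis :
    Σ[ execute ∈ (∀ n (rs : List (Request n)) → Admissible rs → Execution A O (ord n) rs) ]
    (∀ (k : ℕ) → ∃[ C ]
      (∀ n (rs : List (Request n)) (adm : Admissible rs) →
        let m = length (insertions rs)
            q = #comparisons rs
            E = execute n rs adm
        in
        1 ≤ n → n ≤ k * m →
        ∃[ B ]
          (B ≤ C * (m + n * ⌊log₂ n ⌋) √ m)
          × (Execution.maintenanceTime E ≤ B)
          × (Execution.totalTime E ≤ B + C * q)))
  time-analysis = (λ n rs adm → proj₁ (execution n rs adm)) ,
    -- The 3 is the root of the 9 in the estimate; `d` is added so that the same constant covers a
    -- comparison.
    λ k → 3 * (1 + c * (k + 4)) + d , λ n rs adm 1≤n n≤km →
      let m = length (insertions rs)
          S , S²≤ , _ = isqrt (2 * m)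
          _ , maintenance≤ , total≤ = execution n rs adm
      in 1 + c * (n * S + m * (4 + (S + (S + S))))
       , time-bound c k (n * ⌊log₂ n ⌋) d 1≤n n≤km S²≤
       , maintenance≤
       , ≤-trans total≤ (+-mono-≤ maintenance≤
           (*-monoˡ-≤ (#comparisons rs) (m≤n+m d (3 * (1 + c * (k + 4))))))

-- The programs and their correctness on the machine

algorithm : OnlineAlgorithm
algorithm = record
  -- Blank memory already represents empty lists and equal keys; the given n sits in the cell of the
  -- argument `X`.
  { initialise = skip
  ; onInsert   = compile beginInsert ⨾ (whilePos toℕ TOP run compile searchBackward) ⨾
                 compile beginRaise ⨾ (whilePos toℕ TOP run compile searchForward) ⨾ compile link
  ; onCompare  = compile query
  }

-- Built so that its strict order on keys unfolds to `Before`; `topological` can therefore use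
-- `sorted` as it is.
keyOrder : StrictTotalOrder 0ℓ 0ℓ 0ℓ
keyOrder = ×-strictTotalOrder <-strictTotalOrder
  (Flip.strictTotalOrder (×-strictTotalOrder <-strictTotalOrder <-strictTotalOrder))

private module O = StrictTotalOrder keyOrder

ord : ∀ n → Memory → Fin n → O.Carrier
ord n M x = M (cell LEVEL (suc (toℕ x))) , M (cell STAMP (suc (toℕ x))) , M (cell RANK (suc (toℕ x)))

key : State → ℕ → O.Carrier
key σ x = arr σ LEVEL x , arr σ STAMP x , arr σ RANK x

ord≡key : ∀ {n M σ} → M Represents σ → (x : Fin n) → ord n M x ≡ key σ (suc (toℕ x))
ord≡key rep x = cong₂ _,_ (rep .arrs LEVEL _) (cong₂ _,_ (rep .arrs STAMP _) (rep .arrs RANK _))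

record Answers (σ τ : State) : Set where
  constructor answers
  field
    answer : 0 < var τ X ⇔ key σ (suc (var σ X)) O.< key σ (suc (var σ Y))
    arr≡   : arr τ ≡ arr σ
    edges≡ : var τ EDGES ≡ var σ EDGES
    clock≡ : var τ CLOCK ≡ var σ CLOCK

-- A truncated difference is positive exactly for a strict inequality. When both directions fail,
-- the components agree and the next one decides; the difference of the ranks is itself the answer.
query-correct : ∀ σ → Answers σ (exec query σ)
query-correct σ =
  select-elim (Answers σ) (level w ∸ level v) (λ p → answers (yes-case (inj₁ (drop p))) refl refl refl) λ p →
  select-elim (Answers σ) (level v ∸ level w) (λ q → answers (no-case (λ
    { (inj₁ lt) → <-asym lt (drop q) ; (inj₂ (eq , _)) → <⇒≢ (drop q) (sym eq) })) refl refl refl) λ q →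
  let l≡ = ≤-antisym (m∸n≡0⇒m≤n q) (m∸n≡0⇒m≤n p) in
  select-elim (Answers σ) (stamp v ∸ stamp w)
    (λ r → answers (yes-case (inj₂ (l≡ , inj₁ (drop r)))) refl refl refl) λ r →
  select-elim (Answers σ) (stamp w ∸ stamp v) (λ s → answers (no-case (λ
    { (inj₁ lt) → <⇒≢ lt l≡ ; (inj₂ (_ , inj₁ lt)) → <-asym lt (drop s)
    ; (inj₂ (_ , inj₂ (eq , _))) → <⇒≢ (drop s) (sym eq) })) refl refl refl) λ s →
  answers (mk⇔ (λ t → inj₂ (l≡ , inj₂ (≤-antisym (m∸n≡0⇒m≤n s) (m∸n≡0⇒m≤n r) , drop t)))
    (λ { (inj₁ lt) → ⊥-elim (<⇒≢ lt l≡)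
       ; (inj₂ (_ , inj₁ lt)) → ⊥-elim (<⇒≱ lt (m∸n≡0⇒m≤n r))
       ; (inj₂ (_ , inj₂ (_ , lt))) → m<n⇒0<n∸m lt }))
    refl refl refl
  where
  v = suc (var σ X)
  w = suc (var σ Y)
  level = arr σ LEVEL
  stamp = arr σ STAMP
  drop : ∀ {a b} → 0 < a ∸ b → b < a
  drop pos = m∸n≢0⇒n<m (>⇒≢ pos)
  yes-case : key σ v O.< key σ w → 0 < 1 ⇔ key σ v O.< key σ w
  yes-case lt = mk⇔ (λ _ → lt) (λ _ → z<s)
  no-case : ¬ key σ v O.< key σ w → 0 < 0 ⇔ key σ v O.< key σ w
  no-case ≮ = mk⇔ (λ ()) (λ lt → ⊥-elim (≮ lt))

-- Passing arguments and answering queries change only variables, of which the invariant reads just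
-- `EDGES` and `CLOCK`. The graph is repackaged because its fields mention only the arrays in
-- `Static`.
maintained-cong : ∀ {n} {H : List (Edge n)} {S D σ} τ → arr τ ≡ arr σ →
  var τ EDGES ≡ var σ EDGES → var τ CLOCK ≡ var σ CLOCK → Maintained H S D σ → Maintained H S D τ
maintained-cong (state _ _) refl edges clock I = record
  { edges≡ = trans edges edges≡ ; graph = record { Graph graph } ; present = present ; sorted = sorted
  ; stamp≤ = λ x → ≤-trans (stamp≤ x) (≤-reflexive (sym clock))
  ; mark≤ = λ x → ≤-trans (mark≤ x) (≤-reflexive (sym clock))
  ; support = support ; potential = potential }
  where open Maintained I

setArguments : ∀ {n} → State → Edge n → State
setArguments σ (x , y) = setVar (setVar σ X (toℕ x)) Y (toℕ y)

call-represents : ∀ {n M σ} (e : Edge n) → M Represents σ → call M e Represents setArguments σ e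
call-represents (x , y) rep = setVar-represents Y (setVar-represents X rep)

-- The 2 pays for the failing tests of the two loops and each `suc` for the test before a round; the
-- sum dominates the cost of either kind of round.
insertCost : ℕ
insertCost = size beginInsert + (size beginRaise + (size link + 2)) +
  (suc (size searchBackward) + suc (size searchForward))

cost-bound : ∀ {a b r f l i j c} → c ≡ a + (r + (l + 2)) + (b + f) →
  a + ((i * b + 1) + (r + ((j * f + 1) + l))) ≤ c * (1 + (i + j))
cost-bound {a} {b} {r} {f} {l} {i} {j} refl = begin
  a + ((i * b + 1) + (r + ((j * f + 1) + l)))
    ≡⟨ regroup a b r f l i j ⟩
  (a + (r + (l + 2))) + (i * b + j * f)
    ≤⟨ +-mono-≤ (m≤m+n (a + (r + (l + 2))) (b + f)) (+-mono-≤
         (≤-trans (≤-reflexive (*-comm i b)) (*-monoˡ-≤ i b≤))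
         (≤-trans (≤-reflexive (*-comm j f)) (*-monoˡ-≤ j f≤))) ⟩
  c + (c * i + c * j)
    ≡⟨ factor c i j ⟩
  c * (1 + (i + j)) ∎
  where
  open ≤-Reasoning
  c = a + (r + (l + 2)) + (b + f)
  b≤ : b ≤ c
  b≤ = ≤-trans (m≤m+n b f) (m≤n+m _ (a + (r + (l + 2))))
  f≤ : f ≤ c
  f≤ = ≤-trans (m≤n+m f b) (m≤n+m _ (a + (r + (l + 2))))
  regroup : ∀ a b r f l i j → a + ((i * b + 1) + (r + ((j * f + 1) + l))) ≡ (a + (r + (l + 2))) + (i * b + j * f)
  regroup = solve-∀
  factor : ∀ c i j → c + (c * i + c * j) ≡ c * (1 + (i + j))
  factor = solve-∀

insertion-runs : ∀ {n} {H : List (Edge n)} {S D σ M} (I : Inserted H S D σ) → M Represents σ →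
  Runs (OnlineAlgorithm.onInsert algorithm) M
    (insertCost * (1 + (Inserted.backwardSteps I + Inserted.forwardSteps I)))
    (_Represents exec link (Inserted.afterRaise I))
insertion-runs {M = M} I rep = Runs-weaken {OnlineAlgorithm.onInsert algorithm} {M}
  (cost-bound {size beginInsert} {suc (size searchBackward)} {size beginRaise} {suc (size searchForward)} {size link}
    {backwardSteps} {forwardSteps} refl)
  (Runs-seq (compile-correct beginInsert rep) λ rep₁ →
   Runs-seq (while-correct search rep₁) λ rep₂ →
   Runs-seq (compile-correct beginRaise rep₂) λ rep₃ →
   Runs-seq (while-correct raise rep₃) (compile-correct link))
  where open Inserted I

topological : ∀ {n} {H : List (Edge n)} {S D σ M} → Maintained H S D σ → M Represents σ →
  TopologicalOrdering algorithm keyOrder (ord n) H M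
topological {n} {H} {σ = σ} {M} I rep = All.tabulate λ {e} → before e
  where
  open Maintained I
  before : ∀ e → e ∈ H → ord n M (proj₁ e) O.< ord n M (proj₂ e)
  before (x , y) i with present i
  ... | e , r , x≡ , y≡ = subst₂ O._<_
    (trans (cong (key σ) x≡) (sym (ord≡key rep x))) (trans (cong (key σ) y≡) (sym (ord≡key rep y))) (sorted r)

initialState : ℕ → State
initialState n = setVar (state (λ _ → 0) (λ _ _ → 0)) X n

initial-maintained : ∀ n S → Maintained {n} [] S (n * S) (initialState n)
initial-maintained n S = record
  { ins = λ _ → [] ; outs = λ _ → [] ; edges≡ = refl
  ; graph = record
      { arc = empty ; source-range = empty ; target-range = empty
      ; ins-chain = λ _ → refl ; ins-sound = λ () ; ins-complete = empty ; ins-unique = λ _ → []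
      ; outs-chain = λ _ → refl ; outs-sound = λ () ; outs-complete = empty }
  ; present = λ () ; sorted = empty ; stamp≤ = λ _ → z≤n ; mark≤ = λ _ → z≤n
  ; support = λ _ _ ()
  ; potential = ≤-reflexive (trans (sumTo-const n (S * 1)) (cong (n *_) (*-identityʳ S)))
  }
  where
  empty : ∀ {A : Set} {e} → InRange 0 e → A
  empty (0<e , e≤0) = ⊥-elim (<⇒≱ 0<e e≤0)


Good : ∀ {n} → ℕ → List (Edge n) → ℕ → Memory → Set
Good S H D M = Σ[ σ ∈ State ] Maintained H S D σ × M Represents σ

good-initially : ∀ n S → ∃[ M ] ⟨ skip , blank [ 0 ≔ n ] ⟩⇓⟨ 1 , M ⟩ × Good {n} S [] (n * S) M
good-initially n S = _ , skip , initialState n , initial-maintained n S ,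
  setVar-represents X record { vars = λ _ → refl ; arrs = λ _ _ → refl }

good⇒topological : ∀ {n S H D M} → Good {n} S H D M → TopologicalOrdering algorithm keyOrder (ord n) H M
good⇒topological (_ , I , rep) = topological I rep

-- One unit for the straight-line code, 3 + 2 S for the backward search and S for the potential
-- brought in by the new arc make up 4 + 3 S; the forward search is paid from `D`.
insert-time : ∀ {i j D D′ S t c} → i ≤ 3 + (S + S) → j + D′ ≤ D + S → t ≤ c * (1 + (i + j)) →
  t + c * D′ ≤ c * (D + (4 + (S + (S + S))))
insert-time {i} {j} {D} {D′} {S} {t} {c} i≤ j≤ t≤ = begin
  t + c * D′                           ≤⟨ +-monoˡ-≤ (c * D′) t≤ ⟩
  c * (1 + (i + j)) + c * D′           ≡⟨ *-distribˡ-+ c (1 + (i + j)) D′ ⟨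
  c * (1 + (i + j) + D′)               ≡⟨ cong (c *_) (+-assoc (1 + i) j D′) ⟩
  c * (1 + i + (j + D′))               ≤⟨ *-monoʳ-≤ c (+-mono-≤ (s≤s i≤) j≤) ⟩
  c * (1 + (3 + (S + S)) + (D + S))    ≡⟨ cong (c *_) (collect S D) ⟩
  c * (D + (4 + (S + (S + S))))        ∎
  where
  open ≤-Reasoning
  collect : ∀ S D → 1 + (3 + (S + S)) + (D + S) ≡ D + (4 + (S + (S + S)))
  collect = solve-∀

insert-good : ∀ {n S} {H : List (Edge n)} {D M} (e : Edge n) → Acyclic (e ∷ H) →
  (∀ k → k * k ≤ 2 * length H → k ≤ S) → Good S H D M →
  ∃[ t ] ∃[ M′ ] ∃[ D′ ] ⟨ OnlineAlgorithm.onInsert algorithm , call M e ⟩⇓⟨ t , M′ ⟩ ×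
    t + insertCost * D′ ≤ insertCost * (D + (4 + (S + (S + S)))) × Good S (e ∷ H) D′ M′
insert-good {n} {S} {H} {D} {M} e@(x , y) acyclic height-bound (σ , I , rep) =
  after (Insertion.insertion acyclic height-bound refl refl (maintained-cong (setArguments σ e) refl refl refl I))
  where
  after : Inserted (e ∷ H) S D (setArguments σ e) →
    ∃[ t ] ∃[ M′ ] ∃[ D′ ] ⟨ OnlineAlgorithm.onInsert algorithm , call M e ⟩⇓⟨ t , M′ ⟩ ×
      t + insertCost * D′ ≤ insertCost * (D + (4 + (S + (S + S)))) × Good S (e ∷ H) D′ M′
  after J = account (insertion-runs J (call-represents e rep))
    where
    open Inserted J
    account : Runs (OnlineAlgorithm.onInsert algorithm) (call M e)
      (insertCost * (1 + (backwardSteps + forwardSteps))) (_Represents exec link afterRaise) →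
      ∃[ t ] ∃[ M′ ] ∃[ D′ ] ⟨ OnlineAlgorithm.onInsert algorithm , call M e ⟩⇓⟨ t , M′ ⟩ ×
        t + insertCost * D′ ≤ insertCost * (D + (4 + (S + (S + S)))) × Good S (e ∷ H) D′ M′
    account (t , M′ , exe , t≤ , rep′) = t , M′ , D′ , exe
      , insert-time {backwardSteps} {forwardSteps} {D} {D′} {S} {t} {insertCost} search≤ raise≤ t≤
      , exec link afterRaise , maintains , rep′

compare-good : ∀ {n S} {H : List (Edge n)} {D M} (x y : Fin n) → Good S H D M →
  ∃[ t ] ∃[ M′ ] ⟨ compile query , call M (x , y) ⟩⇓⟨ t , M′ ⟩ × t ≤ size query ×
    (0 < M′ 0) ⇔ (ord n M x O.< ord n M y) × (∀ v → ord n M′ v O.≈ ord n M v) × Good S H D M′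
compare-good {n} {S} {H} {D} {M} x y (σ , I , rep) =
  after (query-correct σ′) (compile-correct query (call-represents (x , y) rep))
  where
  σ′ = setArguments σ (x , y)
  after : ∀ {τ} → Answers σ′ τ → Runs (compile query) (call M (x , y)) (size query) (_Represents τ) →
    ∃[ t ] ∃[ M′ ] ⟨ compile query , call M (x , y) ⟩⇓⟨ t , M′ ⟩ × t ≤ size query ×
      (0 < M′ 0) ⇔ (ord n M x O.< ord n M y) × (∀ v → ord n M′ v O.≈ ord n M v) × Good S H D M′
  after {τ} A (t , M′ , exe , t≤ , rep′) =
    t , M′ , exe , t≤ , yes-iff-less , unchanged , τ , maintained-cong τ arr≡ edges≡ clock≡ I , rep′
    where
    open Answers A
    open Equivalence
    yes-iff-less : (0 < M′ 0) ⇔ (ord n M x O.< ord n M y)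
    yes-iff-less = mk⇔
      (λ pos → subst₂ O._<_ (sym (ord≡key rep x)) (sym (ord≡key rep y))
        (to answer (subst (0 <_) (rep′ .vars X) pos)))
      (λ lt → subst (0 <_) (sym (rep′ .vars X))
        (from answer (subst₂ O._<_ (ord≡key rep x) (ord≡key rep y) lt)))
    unchanged : ∀ z → ord n M′ z O.≈ ord n M z
    unchanged z = O.Eq.reflexive (trans (ord≡key rep′ z)
      (trans (cong (λ a → key (state (var σ) a) (suc (toℕ z))) arr≡) (sym (ord≡key rep z))))

theorem2 :
    Σ[ A ∈ OnlineAlgorithm ]
    Σ[ O ∈ StrictTotalOrder 0ℓ 0ℓ 0ℓ ]
    Σ[ ord ∈ (∀ n → Memory → Fin n → StrictTotalOrder.Carrier O) ]
    Σ[ execute ∈ (∀ n (rs : List (Request n)) → Admissible rs → Execution A O (ord n) rs) ]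
    (∀ (c : ℕ) → ∃[ C ]
      (∀ n (rs : List (Request n)) (adm : Admissible rs) →
        let m = length (insertions rs)
            q = #comparisons rs
            E = execute n rs adm
        in
        1 ≤ n → n ≤ c * m →
        ∃[ B ]
          (B ≤ C * (m + n * ⌊log₂ n ⌋) √ m)
          × (Execution.maintenanceTime E ≤ B)
          × (Execution.totalTime E ≤ B + C * q)))
theorem2 = algorithm , keyOrder , ord , Analysis.time-analysis algorithm keyOrder ord insertCost (size query)
  Good good-initially good⇒topological insert-good compare-good
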